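{- Let $p$ be a prime number and let $\Sigma$ be a finite commutative monoid such that $\pi(\Sigma)\subseteq\{p\}$. Let $F:\Sigma^{\mathbb Z}\to\Sigma^{\mathbb Z}$ be a cellular automaton that is also an endomorphism of the monoid $\Sigma^{\mathbb Z}$. If the initial configuration $c:\mathbb Z\to\Sigma$ is $p$-automatic, then its spacetime diagram $(F^j(c)_i)_{(i,j)\in\mathbb Z\times\mathbb N}$ is also $p$-automatic.
   Context: Conventions: $\mathbb N=\{0,1,2,\dots\}$; $\llbracket a,b\rrbracket$ is the set of integers $n$ with $a\le n\le b$; "$u$ is a function of $v$" means that there is a map $h$ with $u=h(v)$ for all values of the parameters. $\Sigma^{\mathbb Z}$ is a monoid with the componentwise operation. Cellular automaton: a map $F:\Sigma^{\mathbb Z}\to\Sigma^{\mathbb Z}$ for which there are a finite set $\mathcal N\subseteq\mathbb Z$ and a map $\lambda:\Sigma^{\mathcal N}\to\Sigma$ with $F(r)_n=\lambda((r_{n+i})_{i\in\mathcal N})$ for all $r\in\Sigma^{\mathbb Z}$, $n\in\mathbb Z$. Period: for an element $x$ of a finite monoid there are least integers $\mathfrak t\ge 0$ and $\mathfrak p>0$ such that $x^{\mathfrak t+\mathfrak p}=x^{\mathfrak t}$; $\mathfrak p$ is called the period of $x$. For a finite monoid $M$, $\pi(M)$ denotes the set of prime divisors of periods of elements of $M$. $k$-automaticity: let $d\ge1$, $k\ge2$ be integers, and let $U$ be a function defined on $D\subseteq\mathbb Z^d$. Extend $U$ to $\mathbb Z^d$ by choosing an element $\bot\notin U(D)$ and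 setting $U(x)=\bot$ for $x\in\mathbb Z^d\setminus D$. $U$ is $k$-automatic if there exist a finite set $E$ and a function $e:\mathbb Z^d\to E$ such that (i) $U(\mathbf n)$ is a function of $e(\mathbf n)$; (ii) for $\mathbf s\in\llbracket 0,k-1\rrbracket^d$ and $\mathbf n\in\mathbb Z^d$, $e(k\mathbf n+\mathbf s)$ is a function of $\mathbf s$ and $e(\mathbf n)$. This is applied with $d=1$ to $c$, and with $d=2$, $D=\mathbb Z\times\mathbb N$ to the spacetime diagram. -}

module Defs where

open import Algebra.Bundles using (CommutativeMonoid)
import Algebra.Construct.Pointwise as Pointwise
import Algebra.Definitions.RawMonoid as RawMonoidDefinitions
open import Algebra.Morphism.Structures using (module MonoidMorphisms)
open import Data.Fin.Base using (Fin; toℕ)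
open import Data.Integer.Base using (ℤ; +_; 0ℤ; ∣_∣; _+_; _*_; _≤_)
open import Data.Integer.Properties using (_≤?_)
open import Data.Maybe.Base using (Maybe; just; nothing)
import Data.Maybe.Relation.Binary.Pointwise as Maybe
open import Data.Nat.Base as ℕ using (ℕ)
open import Data.Nat.Divisibility using (_∣_)
open import Data.Nat.GeneralisedArithmetic using (fold)
open import Data.Nat.Primality using (Prime)
open import Data.Product.Base using (∃; ∃-syntax; _×_)
open import Data.Vec.Base using (Vec; []; _∷_; head; map; zipWith)
import Data.Vec.Relation.Binary.Pointwise.Inductive as Vec
open import Data.Vec.Relation.Unary.Unique.Propositional using (Unique)
open import Function.Bundles using (Inverse)
open import Level using (Level; 0ℓ; _⊔_)
open import Relation.Binary.Bundles using (Setoid)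
open import Relation.Binary.PropositionalEquality using (_≡_; setoid)
open import Relation.Nullary.Decidable.Core using (yes; no)
open import Relation.Unary using (Pred; Decidable; _∈_; U)
open import Relation.Unary.Properties using (U?)

private
  variable
    a ℓ d : Level

Finite : Setoid a ℓ → Set (a ⊔ ℓ)
Finite S = ∃[ n ] Inverse S (setoid (Fin n))

------------------------------------------------------------------------
-- Periods

module _ (M : CommutativeMonoid a ℓ) where
  open CommutativeMonoid M
  open RawMonoidDefinitions rawMonoid using () renaming (_×_ to _·_)

  -- `n · x` is the n-fold product xⁿ.
  IsReturn : Carrier → ℕ → ℕ → Set ℓ
  IsReturn x t p = 0 ℕ.< p × (t ℕ.+ p) · x ≈ t · x

  -- t and p are minimised independently; in a finite monoid the two
  -- minima are attained together.
  IsPeriod : Carrier → ℕ → Set ℓ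
  IsPeriod x p = ∃[ t ] IsReturn x t p ×
    (∀ t′ p′ → IsReturn x t′ p′ → t ℕ.≤ t′ × p ℕ.≤ p′)

  π : Pred ℕ (a ⊔ ℓ)
  π q = Prime q × (∃[ x ] ∃[ n ] IsPeriod x n × q ∣ n)

------------------------------------------------------------------------
-- Cellular automata

module _ (S : Setoid a ℓ) where
  open Setoid S

  record IsCellularAutomaton (F : (ℤ → Carrier) → (ℤ → Carrier)) :
                             Set (a ⊔ ℓ) where
    field
      size          : ℕ
      neighbourhood : Vec ℤ size
      unique        : Unique neighbourhood
      rule          : Vec Carrier size → Carrier
      rule-cong     : ∀ {v w} → Vec.Pointwise _≈_ v w → rule v ≈ rule w
      local         : ∀ r n → F r n ≈ rule (map (λ i → r (n + i)) neighbourhood)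

module _ (M : CommutativeMonoid a ℓ) where
  open CommutativeMonoid M

  IsEndomorphism : ((ℤ → Carrier) → (ℤ → Carrier)) → Set (a ⊔ ℓ)
  IsEndomorphism = MonoidMorphisms.IsMonoidHomomorphism Σ^ℤ Σ^ℤ
    where
    Σ^ℤ = CommutativeMonoid.rawMonoid (Pointwise.commutativeMonoid ℤ M)

------------------------------------------------------------------------
-- Automaticity

ℤ×ℕ : Pred (Vec ℤ 2) 0ℓ
ℤ×ℕ (_ ∷ j ∷ []) = 0ℤ ≤ j

ℤ×ℕ? : Decidable ℤ×ℕ
ℤ×ℕ? (_ ∷ j ∷ []) = 0ℤ ≤? j

module _ (S : Setoid a ℓ) where
  open Setoid S using (Carrier; _≈_)

  -- The extension of f by ⊥ = nothing outside of D.
  extend : ∀ {n} {D : Pred (Vec ℤ n) d} → Decidable D →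
           (∀ x → x ∈ D → Carrier) → Vec ℤ n → Maybe Carrier
  extend D? f x with D? x
  ... | yes x∈D = just (f x x∈D)
  ... | no  _   = nothing

  IsAutomatic : ∀ {n} → ℕ → {D : Pred (Vec ℤ n) d} → Decidable D →
                (∀ x → x ∈ D → Carrier) → Set (a ⊔ ℓ)
  IsAutomatic {n = n} k D? f =
    ∃[ m ] ∃ λ (e : Vec ℤ n → Fin m) →
      (∃ λ (h : Fin m → Maybe Carrier) →
         ∀ x → Maybe.Pointwise _≈_ (extend D? f x) (h (e x))) ×
      (∃ λ (g : Vec (Fin k) n → Fin m → Fin m) →
         ∀ s x → e (zipWith (λ xᵢ sᵢ → + k * xᵢ + + toℕ sᵢ) x s) ≡ g s (e x))

  IsAutomaticConfiguration : ℕ → (ℤ → Carrier) → Set (a ⊔ ℓ)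
  IsAutomaticConfiguration k c =
    IsAutomatic {n = 1} k {D = U} U? (λ x _ → c (head x))

  spacetime : ((ℤ → Carrier) → (ℤ → Carrier)) → (ℤ → Carrier) →
              ∀ x → x ∈ ℤ×ℕ → Carrier
  spacetime F c (i ∷ j ∷ []) _ = fold c F ∣ j ∣ i

  IsAutomaticSpacetime : ℕ → ((ℤ → Carrier) → (ℤ → Carrier)) →
                         (ℤ → Carrier) → Set (a ⊔ ℓ)
  IsAutomaticSpacetime k F c = IsAutomatic k ℤ×ℕ? (spacetime F c)

{-# OPTIONS --safe #-}

-- An endomorphic cellular automaton has the form F(r)ₙ = ∏_d f_d(r_{n+d}), so
-- Fʲ(c)ᵢ is a product of powers y^{X_y(j,i)} over y ∈ Σ, where the exponents
-- X_y : ℕ × ℤ → ℕ solve a linear system with coefficients in z ℕ[u, u⁻¹] (z for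
-- time, u for space). Eliminating unknowns expresses them through rational
-- series in z and u applied to initial rows read off from the automaton of c.
-- As all periods are powers of p, only X_y mod pᵉ and min(X_y, t) matter.
-- For both kinds of coefficients a rational series is a combination, with
-- Laurent polynomial coefficients, of series d such that d(z, u) = q d(zᵖ, uᵖ)
-- with q a Laurent polynomial:
--   * modulo pᵉ, series are fractions, and Q(z, u)^(p pᵉ) = Q(zᵖ, uᵖ)^(pᵉ) makes
--     the inverse of Q^(pᵉ) such a series;
--   * with saturating coefficients, series are sums of terms m h₁⋆ ⋯ hₖ⋆ with
--     monomials m, hᵢ, and h⋆ = (1 + h + ⋯ + hᵖ⁻¹)(hᵖ)⋆.
-- Such a d satisfies a recursion in base p: its values in a window around
-- (j, i) determine those in the window around (p j + r, p i + s).

module Submission where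

open import Defs
open import Algebra.Bundles using (CommutativeMonoid; CommutativeSemiring)
import Algebra.Construct.Pointwise as Pointwise
open import Algebra.Morphism.Structures using (module MonoidMorphisms)
open import Data.Bool.Base using (Bool; true; false; if_then_else_)
open import Data.Fin.Base as Fin
  using (Fin; zero; suc; toℕ; fromℕ; fromℕ<; inject₁; funToFin; finToFun; combine; remQuot)
import Data.Fin.Properties as Fin
open import Data.Integer.Base as ℤ using (ℤ; +_; -[1+_]; 0ℤ)
import Data.Integer.Properties as ℤ
import Data.Integer.Tactic.RingSolver as ℤSolver
open import Data.List.Base using (List; []; _∷_; _++_; foldr; map)
open import Data.List.Relation.Unary.All using (All; []; _∷_)
open import Data.Maybe.Base using (Maybe; just; nothing; maybe′)
import Data.Maybe.Relation.Binary.Pointwise as Maybe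
open import Data.Nat.Base as ℕ using (ℕ; zero; suc; z≤n; s≤s)
open import Data.Nat.Combinatorics using (_C_; nC1≡n; nCn≡1; nCk+nC[k+1]≡[n+1]C[k+1])
open import Data.Nat.Divisibility using (_∣_; divides; ∣⇒≤; ∣-trans; m∣m*n; n∣m*n)
open import Data.Nat.DivMod
  using (_/_; _%_; _mod_; m≡m%n+[m/n]*n; m%n<n; m%n%n≡m%n; m<n⇒m%n≡m; m<n*o⇒m/o<n; m*n%n≡0; %-distribˡ-+)
open import Data.Nat.GeneralisedArithmetic using (fold)
open import Data.Nat.ListAction using (product)
open import Data.Nat.Primality using (Prime; euclidsLemma; ¬prime[0]; ¬prime[1])
open import Data.Nat.Primality.Factorisation using (factorise; module PrimeFactorisation)
import Data.Nat.Properties as ℕ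
import Data.Nat.Tactic.RingSolver as ℕSolver
open import Data.Product.Base using (_,_; ∃; ∃₂; proj₁; proj₂) renaming (_×_ to _∧_)
open import Data.Sum.Base using (inj₁; inj₂)
open import Data.Vec.Base as Vec using (Vec; []; _∷_)
import Data.Vec.Functional as Vector
import Data.Vec.Properties as Vec
import Data.Vec.Relation.Binary.Pointwise.Inductive as VecPointwise
open import Data.Vec.Relation.Unary.All as VecAll using ([]; _∷_)
open import Data.Vec.Relation.Unary.AllPairs.Core using ([]; _∷_)
open import Data.Vec.Relation.Unary.Unique.Propositional using (Unique)
open import Function.Base using (_∘_)
open import Function.Bundles using (Inverse)
open import Level using (Level; 0ℓ; _⊔_)
open import Relation.Binary.PropositionalEquality as ≡ using (_≡_; _≗_; _≢_)
open import Relation.Nullary.Decidable using (Dec; yes; no; does; map′; _×-dec_; dec-true; dec-false)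
open import Relation.Nullary.Negation using (contradiction)
open import Relation.Unary using (Pred; Decidable; _⊆_; ｛_｝)

-- Exponents are tracked because the maps f_d need not commute with each other. On formal exponents
-- each f_d merely relabels elements and shifts positions, so the matrix entries become sums of
-- shifts, which do commute. The price is one unknown for every element of the monoid. For this
-- reason rational series are kept as syntax acting on diagrams over an arbitrary commutative monoid
-- V. Elimination and the construction of automata are done once for all V; only the decomposition
-- into self-similar series is proved twice, once from pᵉ x = 0 and once from (t + 1) x = t x. In
-- the second case a formula for the star of a sum takes over the role of the common denominator.

private
  variable
    v ℓ a b : Level

-- Rational expressions acting on space-time diagrams

-- `star a` stands for (z a)⋆, which makes sense for every a.

infixl 6 _⊕_
infixl 7 _⊗_

data Expr : Set where
  𝟘 𝟙 z   : Expr
  u       : ℤ → Expr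
  _⊕_ _⊗_ : Expr → Expr → Expr
  star    : Expr → Expr

module Action (V : CommutativeMonoid v ℓ) where
  open CommutativeMonoid V
  open import Algebra.Properties.CommutativeSemigroup commutativeSemigroup
    using (interchange)

  Diagram : CommutativeMonoid v ℓ
  Diagram = Pointwise.commutativeMonoid ℕ (Pointwise.commutativeMonoid ℤ V)

  module W = CommutativeMonoid Diagram
  open W public using () renaming (Carrier to W; _≈_ to _≋_; _∙_ to _+ʷ_; ε to 0ʷ)

  delay : W → W
  delay X zero    i = ε
  delay X (suc j) i = X j i

  iterate : (W → W) → W → ℕ → W
  iterate f X zero    = 0ʷ
  iterate f X (suc n) = X +ʷ delay (f (iterate f X n))

  ⟦_⟧ : Expr → W → W
  ⟦ 𝟘 ⟧      X = 0ʷ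
  ⟦ 𝟙 ⟧      X = X
  ⟦ z ⟧      X = delay X
  ⟦ u d ⟧    X = λ j i → X j (i ℤ.- d)
  ⟦ a ⊕ b ⟧  X = ⟦ a ⟧ X +ʷ ⟦ b ⟧ X
  ⟦ a ⊗ b ⟧  X = ⟦ a ⟧ (⟦ b ⟧ X)
  -- Each iteration uses the previous one only through `delay`, so row j is final after `suc j`
  -- iterations.
  ⟦ star a ⟧ X = λ j → iterate ⟦ a ⟧ X (suc j) j

  Agree : ℕ → W → W → Set ℓ
  Agree n X Y = ∀ j → j ℕ.< n → ∀ i → X j i ≈ Y j i

  delay-agree : ∀ {n X Y} → Agree n X Y → Agree (suc n) (delay X) (delay Y)
  delay-agree X≈Y zero    _         i = refl
  delay-agree X≈Y (suc j) (s≤s j<n) i = X≈Y j j<n i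

  Agree-≤ : ∀ {m n X Y} → m ℕ.≤ n → Agree n X Y → Agree m X Y
  Agree-≤ m≤n X≈Y j j<m = X≈Y j (ℕ.<-≤-trans j<m m≤n)

  -- No row depends on later rows. Followed by `delay`, such a map gains one row of agreement; this
  -- contraction gives existence and uniqueness for `star`.
  Causal : (W → W) → Set (v ⊔ ℓ)
  Causal f = ∀ n {X Y} → Agree n X Y → Agree n (f X) (f Y)

  iterate-causal : ∀ {f} → Causal f → ∀ k → Causal (λ X → iterate f X k)
  iterate-causal f-causal zero    n X≈Y j j<n i = refl
  iterate-causal f-causal (suc k) n X≈Y j j<n i = ∙-cong (X≈Y j j<n i)
    (Agree-≤ (ℕ.n≤1+n n) (delay-agree (f-causal n (iterate-causal f-causal k n X≈Y))) j j<n i)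

  causal : ∀ a → Causal ⟦ a ⟧
  causal 𝟘        n X≈Y j j<n i = refl
  causal 𝟙        n X≈Y         = X≈Y
  causal z        n X≈Y         = Agree-≤ (ℕ.n≤1+n n) (delay-agree X≈Y)
  causal (u d)    n X≈Y j j<n i = X≈Y j j<n _
  causal (a ⊕ b)  n X≈Y j j<n i = ∙-cong (causal a n X≈Y j j<n i) (causal b n X≈Y j j<n i)
  causal (a ⊗ b)  n X≈Y         = causal a n (causal b n X≈Y)
  causal (star a) n X≈Y j j<n i = iterate-causal (causal a) (suc j) n X≈Y j j<n i

  ⟦⟧-cong : ∀ a {X Y} → X ≋ Y → ⟦ a ⟧ X ≋ ⟦ a ⟧ Y
  ⟦⟧-cong a X≋Y j i = causal a (suc j) (λ j′ _ → X≋Y j′) j (ℕ.n<1+n j) i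

  iterate-stable : ∀ {f} → Causal f → ∀ {X} m n → m ℕ.≤ n →
                   Agree m (iterate f X n) (iterate f X m)
  iterate-stable f-causal zero    n       _         j ()
  iterate-stable f-causal (suc m) (suc n) (s≤s m≤n) j j<m i = ∙-cong refl
    (delay-agree (f-causal m (iterate-stable f-causal m n m≤n)) j j<m i)

  star-agree : ∀ a X n → Agree n (⟦ star a ⟧ X) (iterate ⟦ a ⟧ X n)
  star-agree a X n j j<n i =
    sym (iterate-stable (causal a) (suc j) n j<n j (ℕ.n<1+n j) i)

  star-unfoldʷ : ∀ a X → ⟦ star a ⟧ X ≋ X +ʷ ⟦ z ⊗ a ⟧ (⟦ star a ⟧ X)
  star-unfoldʷ a X j i = ∙-cong refl
    (sym (delay-agree (causal a j (star-agree a X j)) j (ℕ.n<1+n j) i))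

  -- Agreement below row n passes through `delay` in both equations and becomes agreement below row
  -- n + 1. Identities with stars are mostly proved by checking this equation.
  star-uniqueʷ : ∀ a {X Y} → Y ≋ X +ʷ ⟦ z ⊗ a ⟧ Y → Y ≋ ⟦ star a ⟧ X
  star-uniqueʷ a {X} {Y} eq j = agree (suc j) j (ℕ.n<1+n j)
    where
    agree : ∀ n → Agree n Y (⟦ star a ⟧ X)
    agree zero    j ()
    agree (suc n) j j<n i = trans (eq j i) (trans
      (∙-cong refl (delay-agree (causal a n (agree n)) j j<n i))
      (sym (star-unfoldʷ a X j i)))

  delay-+ : ∀ X Y → delay (X +ʷ Y) ≋ delay X +ʷ delay Y
  delay-+ X Y zero    i = sym (identityˡ ε)
  delay-+ X Y (suc j) i = refl

  delay-0 : delay 0ʷ ≋ 0ʷ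
  delay-0 zero    i = refl
  delay-0 (suc j) i = refl

  ⟦⟧-+ : ∀ a X Y → ⟦ a ⟧ (X +ʷ Y) ≋ ⟦ a ⟧ X +ʷ ⟦ a ⟧ Y
  ⟦⟧-+ 𝟘       X Y j i = sym (identityˡ ε)
  ⟦⟧-+ 𝟙       X Y j i = refl
  ⟦⟧-+ z       X Y     = delay-+ X Y
  ⟦⟧-+ (u d)   X Y j i = refl
  ⟦⟧-+ (a ⊕ b) X Y j i = trans (∙-cong (⟦⟧-+ a X Y j i) (⟦⟧-+ b X Y j i)) (interchange _ _ _ _)
  ⟦⟧-+ (a ⊗ b) X Y     = W.trans (⟦⟧-cong a (⟦⟧-+ b X Y)) (⟦⟧-+ a _ _)
  ⟦⟧-+ (star a) X Y    = W.sym (star-uniqueʷ a λ j i → trans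
    (∙-cong (star-unfoldʷ a X j i) (star-unfoldʷ a Y j i)) (trans
    (interchange _ _ _ _)
    (∙-cong refl (sym (W.trans (⟦⟧-cong z (⟦⟧-+ a _ _)) (delay-+ _ _) j i)))))

  ⟦⟧-0 : ∀ a → ⟦ a ⟧ 0ʷ ≋ 0ʷ
  ⟦⟧-0 𝟘       j i = refl
  ⟦⟧-0 𝟙       j i = refl
  ⟦⟧-0 z           = delay-0
  ⟦⟧-0 (u d)   j i = refl
  ⟦⟧-0 (a ⊕ b) j i = trans (∙-cong (⟦⟧-0 a j i) (⟦⟧-0 b j i)) (identityˡ ε)
  ⟦⟧-0 (a ⊗ b)     = W.trans (⟦⟧-cong a (⟦⟧-0 b)) (⟦⟧-0 a)
  ⟦⟧-0 (star a)    = W.sym (star-uniqueʷ a λ j i →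
    sym (trans (identityˡ _) (W.trans (⟦⟧-cong z (⟦⟧-0 a)) delay-0 j i)))

  Additive : (W → W) → Set (v ⊔ ℓ)
  Additive f = ∀ X Y → f (X +ʷ Y) ≋ f X +ʷ f Y

  -- Both sides solve the equation defining star a.
  star-intertwines : ∀ a b {f : W → W} →
    (∀ {X Y} → X ≋ Y → f X ≋ f Y) → Additive f →
    (∀ X → f (⟦ z ⊗ a ⟧ X) ≋ ⟦ z ⊗ b ⟧ (f X)) →
    ∀ X → f (⟦ star a ⟧ X) ≋ ⟦ star b ⟧ (f X)
  star-intertwines a b f-cong f-+ f-comm X = star-uniqueʷ b
    (W.trans (f-cong (star-unfoldʷ a X)) (W.trans (f-+ _ _)
      (W.∙-cong (λ _ _ → refl) (f-comm _))))

  u-delay : ∀ d X → ⟦ u d ⟧ (delay X) ≋ delay (⟦ u d ⟧ X)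
  u-delay d X zero    i = refl
  u-delay d X (suc j) i = refl

  delay-comm : ∀ a X → delay (⟦ a ⟧ X) ≋ ⟦ a ⟧ (delay X)
  delay-comm 𝟘        X = delay-0
  delay-comm 𝟙        X = W.refl
  delay-comm z        X = W.refl
  delay-comm (u d)    X = W.sym (u-delay d X)
  delay-comm (a ⊕ b)  X = W.trans (delay-+ _ _) (W.∙-cong (delay-comm a X) (delay-comm b X))
  delay-comm (a ⊗ b)  X = W.trans (delay-comm a _) (⟦⟧-cong a (delay-comm b X))
  delay-comm (star a) X = star-intertwines a a (⟦⟧-cong z) delay-+
    (λ Y → ⟦⟧-cong z (delay-comm a Y)) X

  u-comm : ∀ d a X → ⟦ u d ⟧ (⟦ a ⟧ X) ≋ ⟦ a ⟧ (⟦ u d ⟧ X)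
  u-comm d 𝟘        X = W.refl
  u-comm d 𝟙        X = W.refl
  u-comm d z        X = u-delay d X
  u-comm d (u e)    X j i = reflexive (≡.cong (X j) (≡.trans (ℤ.+-assoc i _ _) (≡.trans
    (≡.cong (λ k → i ℤ.+ k) (ℤ.+-comm (ℤ.- d) (ℤ.- e))) (≡.sym (ℤ.+-assoc i _ _)))))
  u-comm d (a ⊕ b)  X = W.∙-cong (u-comm d a X) (u-comm d b X)
  u-comm d (a ⊗ b)  X = W.trans (u-comm d a _) (⟦⟧-cong a (u-comm d b X))
  u-comm d (star a) X = star-intertwines a a (⟦⟧-cong (u d)) (⟦⟧-+ (u d))
    (λ Y → W.trans (u-delay d _) (⟦⟧-cong z (u-comm d a Y))) X

  -- For `star a`, the action of `b` commutes with z and with `a`, so it carries solutions of the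
  -- equation of `star a` to solutions.
  ⟦⟧-comm : ∀ a b X → ⟦ a ⟧ (⟦ b ⟧ X) ≋ ⟦ b ⟧ (⟦ a ⟧ X)
  ⟦⟧-comm 𝟘        b X = W.sym (⟦⟧-0 b)
  ⟦⟧-comm 𝟙        b X = W.refl
  ⟦⟧-comm z        b X = delay-comm b X
  ⟦⟧-comm (u d)    b X = u-comm d b X
  ⟦⟧-comm (a ⊕ c)  b X = W.trans (W.∙-cong (⟦⟧-comm a b X) (⟦⟧-comm c b X)) (W.sym (⟦⟧-+ b _ _))
  ⟦⟧-comm (a ⊗ c)  b X = W.trans (⟦⟧-cong a (⟦⟧-comm c b X)) (⟦⟧-comm a b _)
  ⟦⟧-comm (star a) b X = W.sym (star-intertwines a a (⟦⟧-cong b) (⟦⟧-+ b)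
    (λ Y → W.trans (W.sym (delay-comm b _)) (⟦⟧-cong z (W.sym (⟦⟧-comm a b Y)))) X)

  infix 4 _≈ᵉ_

  -- Equality by action turns relations that hold in V, such as torsion or saturation, into
  -- identities between expressions; so one syntax serves both kinds of coefficients.
  record _≈ᵉ_ (a b : Expr) : Set (v ⊔ ℓ) where
    constructor mk
    field act : ∀ X → ⟦ a ⟧ X ≋ ⟦ b ⟧ X
  open _≈ᵉ_ public

  exprs : CommutativeSemiring 0ℓ (v ⊔ ℓ)
  exprs = record
    { Carrier = Expr
    ; _≈_ = _≈ᵉ_
    ; _+_ = _⊕_
    ; _*_ = _⊗_
    ; 0# = 𝟘
    ; 1# = 𝟙
    ; isCommutativeSemiring = record
      { isSemiring = record
        { isSemiringWithoutAnnihilatingZero = record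
          { +-isCommutativeMonoid = record
            { isMonoid = record
              { isSemigroup = record
                { isMagma = record
                  { isEquivalence = record
                    { refl = mk λ _ → W.refl
                    ; sym = λ p → mk λ X → W.sym (act p X)
                    ; trans = λ p q → mk λ X → W.trans (act p X) (act q X)
                    }
                  ; ∙-cong = λ p q → mk λ X → W.∙-cong (act p X) (act q X)
                  }
                ; assoc = λ _ _ _ → mk λ X → W.assoc _ _ _
                }
              ; identity = (λ _ → mk λ X → W.identityˡ _) , (λ _ → mk λ X → W.identityʳ _)
              }
            ; comm = λ _ _ → mk λ X → W.comm _ _
            }
          ; *-cong = λ {a} p q → mk λ X → W.trans (⟦⟧-cong a (act q X)) (act p _)
          ; *-assoc = λ _ _ _ → mk λ X → W.refl
          ; *-identity = (λ _ → mk λ X → W.refl) , (λ _ → mk λ X → W.refl)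
          ; distrib = (λ a _ _ → mk λ X → ⟦⟧-+ a _ _) , (λ _ _ _ → mk λ X → W.refl)
          }
        ; zero = (λ _ → mk λ X → W.refl) , (λ a → mk λ X → ⟦⟧-0 a)
        }
      ; *-comm = λ a b → mk λ X → ⟦⟧-comm a b X
      }
    }

  star-unfold : ∀ a → star a ≈ᵉ 𝟙 ⊕ z ⊗ a ⊗ star a
  star-unfold a = mk λ X → star-unfoldʷ a X

  star-unique : ∀ a {b c} → c ≈ᵉ b ⊕ z ⊗ a ⊗ c → c ≈ᵉ star a ⊗ b
  star-unique a eq = mk λ X → star-uniqueʷ a (act eq X)

-- Binomial coefficients and powers modulo p

C-absorption : ∀ n k → suc k ℕ.* (suc n C suc k) ≡ suc n ℕ.* (n C k)
C-absorption zero    zero    = ≡.refl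
C-absorption zero    (suc k) = ℕ.*-zeroʳ (suc (suc k))
C-absorption (suc n) zero    = ≡.trans (ℕ.*-identityˡ _) (≡.trans (nC1≡n (suc (suc n))) (≡.sym (ℕ.*-identityʳ _)))
C-absorption (suc n) (suc k) = begin
  (2 ℕ.+ k) ℕ.* (suc (suc n) C (2 ℕ.+ k))
    ≡⟨ ≡.cong ((2 ℕ.+ k) ℕ.*_) (nCk+nC[k+1]≡[n+1]C[k+1] (suc n) (suc k)) ⟨
  (2 ℕ.+ k) ℕ.* (x ℕ.+ y)
    ≡⟨ lemma₁ k x y ⟩
  x ℕ.+ (suc k ℕ.* x ℕ.+ (2 ℕ.+ k) ℕ.* y)
    ≡⟨ ≡.cong (x ℕ.+_) (≡.cong₂ ℕ._+_ (C-absorption n k) (C-absorption n (suc k))) ⟩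
  x ℕ.+ (suc n ℕ.* (n C k) ℕ.+ suc n ℕ.* (n C suc k))
    ≡⟨ ≡.cong (x ℕ.+_) (ℕ.*-distribˡ-+ (suc n) (n C k) (n C suc k)) ⟨
  x ℕ.+ suc n ℕ.* (n C k ℕ.+ n C suc k)
    ≡⟨ ≡.cong (λ m → x ℕ.+ suc n ℕ.* m) (nCk+nC[k+1]≡[n+1]C[k+1] n k) ⟩
  (2 ℕ.+ n) ℕ.* x ∎
  where
  open ≡.≡-Reasoning
  x = suc n C suc k
  y = suc n C (2 ℕ.+ k)
  lemma₁ : ∀ k x y → (2 ℕ.+ k) ℕ.* (x ℕ.+ y) ≡ x ℕ.+ (suc k ℕ.* x ℕ.+ (2 ℕ.+ k) ℕ.* y)
  lemma₁ = ℕSolver.solve-∀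

-- By absorption p divides the product of `suc k` and the binomial coefficient, and `suc k` is too
-- small to be divisible by p.
prime∣C : ∀ {n} → Prime (suc n) → ∀ k → k ℕ.< n → suc n ∣ suc n C suc k
prime∣C {n} p-prime k k<n with euclidsLemma (suc k) (suc n C suc k) p-prime
  (≡.subst (suc n ∣_) (≡.sym (C-absorption n k)) (m∣m*n _))
... | inj₁ p∣k = contradiction (∣⇒≤ p∣k) (ℕ.<⇒≱ (s≤s k<n))
... | inj₂ p∣C = p∣C

module Powers (S : CommutativeSemiring v ℓ) where
  open CommutativeSemiring S hiding (zero)
  open import Algebra.Properties.Semiring.Exp semiring
  open import Algebra.Properties.CommutativeSemiring.Exp S using (^-distrib-*)
  open import Algebra.Properties.Semiring.Mult semiring renaming (_×_ to _·_)
  open import Algebra.Properties.CommutativeMonoid.Mult +-commutativeMonoid using (×-distrib-+)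
  open import Algebra.Properties.Semiring.Sum semiring
  open import Algebra.Properties.CommutativeSemiring.Binomial S using (theorem)
  open import Algebra.Solver.Ring.NaturalCoefficients.Default S using (solve; _:=_; _:+_; _:*_; con)
  open import Relation.Binary.Reasoning.Setoid setoid

  ×-zeroʳ : ∀ m → m · 0# ≈ 0#
  ×-zeroʳ zero    = refl
  ×-zeroʳ (suc m) = trans (+-identityˡ _) (×-zeroʳ m)

  ∣⇒× : ∀ {m n} → m ∣ n → ∀ x → ∃ λ r → n · x ≈ m · r
  ∣⇒× {m} (divides q ≡.refl) x = q · x ,
    trans (×-congˡ (ℕ.*-comm q m)) (sym (×-assocˡ x m q))

  sum-× : ∀ m {n} (f : Fin n → Carrier) → (∀ i → ∃ λ r → f i ≈ m · r) →
          ∃ λ r → sum f ≈ m · r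
  sum-× m {zero}  f m∣f = 0# , sym (×-zeroʳ m)
  sum-× m {suc n} f m∣f with m∣f zero | sum-× m (f ∘ suc) (m∣f ∘ suc)
  ... | r , eq | s , eq′ = r + s , trans (+-cong eq eq′) (sym (×-distrib-+ r s m))

  -- In the absence of subtraction, a congruence modulo p carries its multiple of p explicitly on
  -- one side. Here the inner binomial terms supply it.
  freshman : ∀ {p} → Prime p → ∀ x y → ∃ λ r → (x + y) ^ p ≈ x ^ p + y ^ p + p · r
  freshman {suc n} p-prime x y = proj₁ middle , (begin
    (x + y) ^ suc n
      ≈⟨ theorem (suc n) x y ⟩
    t zero + sum (t ∘ suc)
      ≈⟨ +-cong first (sum-init-last (t ∘ suc)) ⟩
    y ^ suc n + (sum (λ i → t (suc (inject₁ i))) + t (fromℕ (suc n)))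
      ≈⟨ +-congˡ (+-cong (proj₂ middle) last≈) ⟩
    y ^ suc n + (suc n · proj₁ middle + x ^ suc n)
      ≈⟨ solve 3 (λ a b c → b :+ (c :+ a) := a :+ b :+ c)
           refl (x ^ suc n) (y ^ suc n) (suc n · proj₁ middle) ⟩
    x ^ suc n + y ^ suc n + suc n · proj₁ middle ∎)
    where
    t : Fin (suc (suc n)) → Carrier
    t k = (suc n C toℕ k) · (x ^ toℕ k * y ^ (suc n ℕ.∸ toℕ k))
    first : t zero ≈ y ^ suc n
    first = trans (+-identityʳ _) (*-identityˡ _)
    last≈ : t (fromℕ (suc n)) ≈ x ^ suc n
    last≈ rewrite Fin.toℕ-fromℕ n | nCn≡1 (suc n) | ℕ.n∸n≡0 n =
      trans (+-identityʳ _) (*-identityʳ _)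
    middle : ∃ λ r → sum (λ i → t (suc (inject₁ i))) ≈ suc n · r
    middle = sum-× (suc n) _ λ i → ∣⇒× (prime∣C p-prime _
      (≡.subst (ℕ._< n) (≡.sym (Fin.toℕ-inject₁ i)) (Fin.toℕ<n i))) _

  frobenius-+ : ∀ {p} → Prime p → ∀ {x y x′ y′} →
                ∃ (λ r → x ^ p ≈ x′ + p · r) → ∃ (λ r → y ^ p ≈ y′ + p · r) →
                ∃ λ r → (x + y) ^ p ≈ x′ + y′ + p · r
  frobenius-+ {p} p-prime {x} {y} {x′} {y′} (r , eq) (s , eq′) with freshman p-prime x y
  ... | t , eq″ = r + s + t , (begin
    (x + y) ^ p
      ≈⟨ eq″ ⟩
    x ^ p + y ^ p + p · t
      ≈⟨ +-congʳ (+-cong eq eq′) ⟩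
    x′ + p · r + (y′ + p · s) + p · t
      ≈⟨ solve 5 (λ a b r s t → a :+ r :+ (b :+ s) :+ t := a :+ b :+ (r :+ s :+ t))
           refl x′ y′ (p · r) (p · s) (p · t) ⟩
    x′ + y′ + (p · r + p · s + p · t)
      ≈⟨ +-congˡ (+-congʳ (×-distrib-+ r s p)) ⟨
    x′ + y′ + (p · (r + s) + p · t)
      ≈⟨ +-congˡ (×-distrib-+ (r + s) t p) ⟨
    x′ + y′ + p · (r + s + t) ∎)

  frobenius-* : ∀ {p x y x′ y′} →
                ∃ (λ r → x ^ p ≈ x′ + p · r) → ∃ (λ r → y ^ p ≈ y′ + p · r) →
                ∃ λ r → (x * y) ^ p ≈ x′ * y′ + p · r
  frobenius-* {p} {x} {y} {x′} {y′} (r , eq) (s , eq′) = r * (y′ + p · s) + x′ * s , (begin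
    (x * y) ^ p
      ≈⟨ ^-distrib-* x y p ⟩
    x ^ p * y ^ p
      ≈⟨ *-cong eq eq′ ⟩
    (x′ + p · r) * (y′ + p · s)
      ≈⟨ solve 4 (λ a b r s → (a :+ r) :* (b :+ s) := a :* b :+ (r :* (b :+ s) :+ a :* s))
           refl x′ y′ (p · r) (p · s) ⟩
    x′ * y′ + ((p · r) * (y′ + p · s) + x′ * p · s)
      ≈⟨ +-congˡ (+-cong (×-assoc-* p r _) (×-comm-* p x′ s)) ⟩
    x′ * y′ + (p · (r * (y′ + p · s)) + p · (x′ * s))
      ≈⟨ +-congˡ (×-distrib-+ _ _ p) ⟨
    x′ * y′ + p · (r * (y′ + p · s) + x′ * s) ∎)

  -- A first-order Taylor expansion: the linear term exhibits the exponent as a factor, and all the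
  -- rest carries the square of m.
  binomial₂ : ∀ m n x r → ∃ λ s →
              (x + m · r) ^ suc n ≈ x ^ suc n + m · (suc n · (r * x ^ n)) + (m ℕ.* m) · s
  binomial₂ m zero    x r = 0# , (begin
    (x + m · r) * 1#
      ≈⟨ *-congʳ (+-congˡ (×-congʳ m (sym (trans (+-identityʳ _) (*-identityʳ r))))) ⟩
    (x + m · (1 · (r * 1#))) * 1#
      ≈⟨ solve 2 (λ a b → (a :+ b) :* con 1 := a :* con 1 :+ b :+ con 0) refl x _ ⟩
    x * 1# + m · (1 · (r * 1#)) + 0#
      ≈⟨ +-congˡ (×-zeroʳ (m ℕ.* m)) ⟨
    x * 1# + m · (1 · (r * 1#)) + (m ℕ.* m) · 0# ∎)
  binomial₂ m (suc n) x r with binomial₂ m n x r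
  ... | s , eq = r * (suc n · (r * y)) + (x + m · r) * s , (begin
    (x + m · r) * (x + m · r) ^ suc n
      ≈⟨ *-congˡ eq ⟩
    (x + m · r) * (x * y + m · T + (m ℕ.* m) · s)
      ≈⟨ solve 5 (λ x R y T U → (x :+ R) :* (x :* y :+ T :+ U)
              := x :* (x :* y) :+ (R :* (x :* y) :+ x :* T) :+ (R :* T :+ (x :+ R) :* U))
           refl x (m · r) y (m · T) ((m ℕ.* m) · s) ⟩
    x * (x * y) + ((m · r) * (x * y) + x * (m · T)) + ((m · r) * (m · T) + (x + m · r) * ((m ℕ.* m) · s))
      ≈⟨ +-cong (+-congˡ (+-cong (×-assoc-* m r _) (×-comm-* m x T)))
           (+-cong (trans (×-assoc-* m r _) (trans (×-congʳ m (×-comm-* m r T)) (×-assocˡ _ m m))) (×-comm-* (m ℕ.* m) _ s)) ⟩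
    x * (x * y) + (m · (r * (x * y)) + m · (x * T)) + ((m ℕ.* m) · (r * T) + (m ℕ.* m) · ((x + m · r) * s))
      ≈⟨ +-cong (+-congˡ (sym (×-distrib-+ _ _ m))) (sym (×-distrib-+ _ _ (m ℕ.* m))) ⟩
    x * (x * y) + m · (r * (x * y) + x * T) + (m ℕ.* m) · (r * T + (x + m · r) * s)
      ≈⟨ +-congʳ (+-congˡ (×-congʳ m (+-congˡ (trans (×-comm-* (suc n) x _) (×-congʳ (suc n)
          (solve 3 (λ x r y → x :* (r :* y) := r :* (x :* y)) refl x r y)))))) ⟩
    x * (x * y) + m · (suc (suc n) · (r * (x * y))) + (m ℕ.* m) · (r * T + (x + m · r) * s) ∎)
    where
    y = x ^ n
    T = suc n · (r * y)

  -- In the p-th power the linear term gains a factor p from the exponent, and the rest carries (p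
  -- m)², a multiple of p (p m). So every p-th power improves the modulus by a factor p.
  lift-congruence : ∀ p m x {y r} → x ≈ y + (p ℕ.* m) · r →
                    ∃ λ s → x ^ p ≈ y ^ p + (p ℕ.* (p ℕ.* m)) · s
  lift-congruence zero    m x {y} eq = 0# , sym (+-identityʳ _)
  lift-congruence (suc n) m x {y} {r} eq with binomial₂ (suc n ℕ.* m) n y r
  ... | s , eq′ = r * y ^ n + m · s , (begin
    x ^ p
      ≈⟨ ^-congˡ p eq ⟩
    (y + k · r) ^ p
      ≈⟨ eq′ ⟩
    y ^ p + k · (p · (r * y ^ n)) + (k ℕ.* k) · s
      ≈⟨ +-congʳ (+-congˡ (×-assocˡ _ k p)) ⟩
    y ^ p + (k ℕ.* p) · (r * y ^ n) + (k ℕ.* k) · s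
      ≈⟨ +-cong (+-congˡ (×-congˡ (ℕ.*-comm k p))) (×-congˡ (lemma₂ p m)) ⟩
    y ^ p + (p ℕ.* k) · (r * y ^ n) + (p ℕ.* k ℕ.* m) · s
      ≈⟨ +-congˡ (sym (×-assocˡ s (p ℕ.* k) m)) ⟩
    y ^ p + (p ℕ.* k) · (r * y ^ n) + (p ℕ.* k) · (m · s)
      ≈⟨ +-assoc _ _ _ ⟩
    y ^ p + ((p ℕ.* k) · (r * y ^ n) + (p ℕ.* k) · (m · s))
      ≈⟨ +-congˡ (sym (×-distrib-+ _ _ (p ℕ.* k))) ⟩
    y ^ p + (p ℕ.* k) · (r * y ^ n + m · s) ∎)
    where
    p = suc n
    k = p ℕ.* m
    lemma₂ : ∀ p m → p ℕ.* m ℕ.* (p ℕ.* m) ≡ p ℕ.* (p ℕ.* m) ℕ.* m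
    lemma₂ = ℕSolver.solve-∀

  lift-congruence-^ : ∀ p n {x y r} → x ≈ y + p · r →
                      ∃ λ s → x ^ (p ℕ.^ n) ≈ y ^ (p ℕ.^ n) + (p ℕ.^ suc n) · s
  lift-congruence-^ p zero {x} {y} {r} eq = r , trans (*-identityʳ x) (trans eq
    (+-cong (sym (*-identityʳ y)) (×-congˡ (≡.sym (ℕ.*-identityʳ p)))))
  lift-congruence-^ p (suc n) {x} {y} eq with lift-congruence-^ p n eq
  ... | s , eq′ with lift-congruence p (p ℕ.^ n) (x ^ (p ℕ.^ n)) eq′
  ...   | s′ , eq″ = s′ , trans (power x) (trans eq″ (+-congʳ (sym (power y))))
    where
    power : ∀ x → x ^ (p ℕ.^ suc n) ≈ (x ^ (p ℕ.^ n)) ^ p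
    power x = trans (^-congʳ x (ℕ.*-comm p (p ℕ.^ n))) (sym (^-assocʳ x (p ℕ.^ n) p))

-- The Frobenius substitution; coefficients modulo a power of p

data StarFree : Expr → Set where
  𝟘   : StarFree 𝟘
  𝟙   : StarFree 𝟙
  z   : StarFree z
  u   : ∀ d → StarFree (u d)
  _⊕_ : ∀ {a b} → StarFree a → StarFree b → StarFree (a ⊕ b)
  _⊗_ : ∀ {a b} → StarFree a → StarFree b → StarFree (a ⊗ b)

data Monomial : Expr → Set where
  𝟙   : Monomial 𝟙
  z   : Monomial z
  u   : ∀ d → Monomial (u d)
  _⊗_ : ∀ {a b} → Monomial a → Monomial b → Monomial (a ⊗ b)

monomial⇒starFree : ∀ {a} → Monomial a → StarFree a
monomial⇒starFree 𝟙       = 𝟙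
monomial⇒starFree z       = z
monomial⇒starFree (u d)   = u d
monomial⇒starFree (h ⊗ k) = monomial⇒starFree h ⊗ monomial⇒starFree k

module Frobenius (V : CommutativeMonoid v ℓ) (p⁻ : ℕ) where
  open Action V
  open CommutativeSemiring exprs hiding (zero)
  open import Algebra.Properties.Semiring.Exp semiring public using (_^_; ^-congˡ; ^-homo-*; ^-assocʳ)
  open import Algebra.Properties.CommutativeSemiring.Exp exprs public using (^-distrib-*)
  open import Algebra.Properties.Semiring.Mult semiring public
    using (×-congˡ; ×-congʳ; ×-assocˡ; ×-comm-*) renaming (_×_ to _·_)
  open import Algebra.Properties.CommutativeMonoid.Mult +-commutativeMonoid public using (×-distrib-+)
  open import Algebra.Solver.Ring.NaturalCoefficients.Default exprs public
    using (solve; _:=_; _:+_; _:*_; con)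
  open import Relation.Binary.Reasoning.Setoid setoid

  p : ℕ
  p = suc p⁻

  ψ : Expr → Expr
  ψ 𝟘        = 𝟘
  ψ 𝟙        = 𝟙
  ψ z        = z ^ p
  ψ (u d)    = u (+ p ℤ.* d)
  ψ (a ⊕ b)  = ψ a ⊕ ψ b
  ψ (a ⊗ b)  = ψ a ⊗ ψ b
  -- `star` brings one factor z of its own, so only p - 1 of the p factors are written out.
  ψ (star a) = star (z ^ p⁻ ⊗ ψ a)

  ψ-^ : ∀ a n → ψ (a ^ n) ≡ ψ a ^ n
  ψ-^ a zero    = ≡.refl
  ψ-^ a (suc n) = ≡.cong (ψ a ⊗_) (ψ-^ a n)

  ψ-· : ∀ n a → ψ (n · a) ≡ n · ψ a
  ψ-· zero    a = ≡.refl
  ψ-· (suc n) a = ≡.cong (ψ a ⊕_) (ψ-· n a)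

  u-+ : ∀ d e → u d ⊗ u e ≈ u (d ℤ.+ e)
  u-+ d e = mk λ X j i → V.reflexive (≡.cong (X j) (≡.trans (ℤ.+-assoc i _ _)
    (≡.cong (λ k → i ℤ.+ k) (≡.sym (ℤ.neg-distrib-+ d e)))))
    where module V = CommutativeMonoid V

  u-0 : u (+ 0) ≈ 𝟙
  u-0 = mk λ X j i → V.reflexive (≡.cong (X j) (ℤ.+-identityʳ i))
    where module V = CommutativeMonoid V

  u-^ : ∀ d n → u d ^ n ≈ u (+ n ℤ.* d)
  u-^ d zero    = sym (trans (reflexive (≡.cong u (ℤ.*-zeroˡ d))) u-0)
  u-^ d (suc n) = trans (*-congˡ (u-^ d n)) (trans (u-+ d _)
    (reflexive (≡.cong u (≡.sym (ℤ.suc-* (+ n) d)))))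

  𝟙^n : ∀ n → 𝟙 ^ n ≈ 𝟙
  𝟙^n zero    = refl
  𝟙^n (suc n) = trans (*-identityˡ _) (𝟙^n n)

  -- A product has no cross terms, so no remainder appears, whatever the coefficients. This is why
  -- the saturating case allows only monomials under a star.
  monomial-ψ : ∀ {a} → Monomial a → ψ a ≈ a ^ p
  monomial-ψ 𝟙       = sym (𝟙^n p)
  monomial-ψ z       = refl
  monomial-ψ (u d)   = sym (u-^ d p)
  monomial-ψ (h ⊗ k) = trans (*-cong (monomial-ψ h) (monomial-ψ k)) (sym (^-distrib-* _ _ p))

  starFree-^ : ∀ {a} → StarFree a → ∀ n → StarFree (a ^ n)
  starFree-^ P zero    = 𝟙
  starFree-^ P (suc n) = P ⊗ starFree-^ P n

  starFree-· : ∀ {a} → StarFree a → ∀ n → StarFree (n · a)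
  starFree-· P zero    = 𝟘
  starFree-· P (suc n) = P ⊕ starFree-· P n

  star-cong : ∀ {a b} → a ≈ b → star a ≈ star b
  star-cong {a} {b} a≈b = trans (star-unique b (trans (star-unfold a)
    (+-congˡ (*-congʳ (*-congˡ a≈b))))) (*-identityʳ _)

  star-𝟘 : star 𝟘 ≈ 𝟙
  star-𝟘 = trans (star-unfold 𝟘) (trans (+-congˡ (trans (*-congʳ (zeroʳ z)) (zeroˡ _))) (+-identityʳ 𝟙))

  -- With x = z a, y = z b and c = 1 + x (x + y)⋆, one has (x + y)⋆ = y⋆ c, hence c = 1 + x y⋆ c.
  -- Read from left to right, the identity removes a nested star.
  star-⊗-star : ∀ a b → star (a ⊗ star b) ≈ 𝟙 ⊕ z ⊗ a ⊗ star (a ⊕ b)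
  star-⊗-star a b = sym (trans (star-unique (a ⊗ star b) eq) (*-identityʳ _))
    where
    Z = star (a ⊕ b)
    c = 𝟙 ⊕ z ⊗ a ⊗ Z
    Z≈ : Z ≈ star b ⊗ c
    Z≈ = star-unique b (trans (star-unfold (a ⊕ b))
      (solve 4 (λ z a b Z → con 1 :+ z :* (a :+ b) :* Z := con 1 :+ z :* a :* Z :+ z :* b :* Z)
           refl z a b Z))
    eq : c ≈ 𝟙 ⊕ z ⊗ (a ⊗ star b) ⊗ c
    eq = +-congˡ (trans (*-congˡ Z≈)
      (solve 4 (λ z a b c → z :* a :* (b :* c) := z :* (a :* b) :* c) refl z a (star b) c))

  SelfSimilar : Expr → Set (v ⊔ ℓ)
  SelfSimilar d = ∃ λ q → StarFree q ∧ d ≈ q ⊗ ψ d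

  data Decomposed : Expr → Set (v ⊔ ℓ) where
    𝟘   : Decomposed 𝟘
    add : ∀ {q d b} → StarFree q → SelfSimilar d → Decomposed b → Decomposed (q ⊗ d ⊕ b)

  Decomposable : Expr → Set (v ⊔ ℓ)
  Decomposable a = ∃ λ b → Decomposed b ∧ a ≈ b

  module V where
    open CommutativeMonoid V public
    open import Algebra.Properties.Monoid.Mult monoid public using () renaming (_×_ to _·_)

  ⟦·⟧ : ∀ n a X j i → ⟦ n · a ⟧ X j i V.≈ n V.· ⟦ a ⟧ X j i
  ⟦·⟧ zero    a X j i = V.refl
  ⟦·⟧ (suc n) a X j i = V.∙-cong V.refl (⟦·⟧ n a X j i)

  module Torsion (p-prime : Prime p) (e ν : ℕ) (p^e≡1+ν : p ℕ.^ e ≡ suc ν)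
                 (torsion : ∀ x → suc ν V.· x V.≈ V.ε) where

    torsionᵉ : ∀ a → suc ν · a ≈ 𝟘
    torsionᵉ a = mk λ X j i → V.trans (⟦·⟧ (suc ν) a X j i) (torsion _)

    -- Modulo pᵉ the number ν = pᵉ - 1 acts as -1, which gives subtraction although the syntax has
    -- only natural coefficients.
    -1ᵉ : Expr
    -1ᵉ = ν · 𝟙

    -1-inverse : 𝟙 ⊕ -1ᵉ ≈ 𝟘
    -1-inverse = torsionᵉ 𝟙

    den : Expr → Expr
    den a = 𝟙 ⊕ -1ᵉ ⊗ (z ⊗ a)

    den-star : ∀ a → den a ⊗ star a ≈ 𝟙
    den-star a = begin
      (𝟙 ⊕ m ⊗ x) ⊗ s
        ≈⟨ solve 3 (λ m x s → (con 1 :+ m :* x) :* s := s :+ m :* (x :* s)) refl m x s ⟩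
      s ⊕ m ⊗ (x ⊗ s)
        ≈⟨ +-congʳ (star-unfold a) ⟩
      𝟙 ⊕ x ⊗ s ⊕ m ⊗ (x ⊗ s)
        ≈⟨ solve 2 (λ m y → con 1 :+ y :+ m :* y := con 1 :+ (con 1 :+ m) :* y) refl m (x ⊗ s) ⟩
      𝟙 ⊕ (𝟙 ⊕ m) ⊗ (x ⊗ s)
        ≈⟨ +-congˡ (trans (*-congʳ -1-inverse) (zeroˡ _)) ⟩
      𝟙 ⊕ 𝟘
        ≈⟨ +-identityʳ _ ⟩
      𝟙 ∎
      where
      m = -1ᵉ
      x = z ⊗ a
      s = star a

    starFree-den : ∀ {a} → StarFree a → StarFree (den a)
    starFree-den q = 𝟙 ⊕ starFree-· 𝟙 ν ⊗ (z ⊗ q)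

    ψ-den : ∀ a → ψ (den a) ≈ den (z ^ p⁻ ⊗ ψ a)
    ψ-den a = +-congˡ (*-cong (reflexive (ψ-· ν 𝟙)) (*-assoc z (z ^ p⁻) (ψ a)))

    -- Integer coefficients are sums of `𝟙`, so the additive case already contains Fermat's little
    -- theorem.
    frobenius : ∀ {a} → StarFree a → ∃ λ r → a ^ p ≈ ψ a ⊕ p · r
    frobenius 𝟘       = 𝟘 , trans (zeroˡ _) (sym (trans (+-identityˡ _) (Powers.×-zeroʳ exprs p)))
    frobenius 𝟙       = 𝟘 , sym (trans (+-cong (monomial-ψ 𝟙) (Powers.×-zeroʳ exprs p)) (+-identityʳ _))
    frobenius z       = 𝟘 , sym (trans (+-congˡ (Powers.×-zeroʳ exprs p)) (+-identityʳ _))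
    frobenius (u d)   = 𝟘 , sym (trans (+-cong (monomial-ψ (u d)) (Powers.×-zeroʳ exprs p)) (+-identityʳ _))
    frobenius (A ⊕ B) = Powers.frobenius-+ exprs p-prime (frobenius A) (frobenius B)
    frobenius (A ⊗ B) = Powers.frobenius-* exprs {p} (frobenius A) (frobenius B)

    -- Raising to the power pᵉ improves the congruence from modulus p to modulus p^(e+1), and pᵉ
    -- kills V.
    frobenius-lifted : ∀ {a} → StarFree a → (a ^ p) ^ suc ν ≈ ψ a ^ suc ν
    frobenius-lifted {a} A with Powers.lift-congruence-^ exprs p e (proj₂ (frobenius A))
    ... | s , eq rewrite p^e≡1+ν = trans eq (trans (+-congˡ
      (trans (×-congˡ (ℕ.*-comm p (suc ν)))
      (trans (sym (×-assocˡ s (suc ν) p)) (torsionᵉ _)))) (+-identityʳ _))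

    -- Let d = 1 - z a, so s = 1/d, and let n = pᵉ. Then s^n = d^(pn - n) / d^(pn), where d^(pn) =
    -- ψ(d)^n has the inverse ψ(s^n).
    star-selfSimilar : ∀ {a} → StarFree a → SelfSimilar (star a ^ suc ν)
    star-selfSimilar {a} A = d ^ (p⁻ ℕ.* n) , starFree-^ D (p⁻ ℕ.* n) , (begin
      s ^ n
        ≈⟨ *-identityʳ _ ⟨
      s ^ n ⊗ 𝟙
        ≈⟨ *-congˡ ψd^n⊗ψs^n ⟨
      s ^ n ⊗ (ψ d ^ n ⊗ ψ (s ^ n))
        ≈⟨ *-congˡ (*-congʳ (trans (sym (frobenius-lifted D)) (trans (^-assocʳ d p n) (^-homo-* d n (p⁻ ℕ.* n))))) ⟩
      s ^ n ⊗ (d ^ n ⊗ d ^ (p⁻ ℕ.* n) ⊗ ψ (s ^ n))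
        ≈⟨ solve 4 (λ s d e f → s :* (d :* e :* f) := d :* s :* (e :* f))
             refl (s ^ n) (d ^ n) (d ^ (p⁻ ℕ.* n)) (ψ (s ^ n)) ⟩
      d ^ n ⊗ s ^ n ⊗ (d ^ (p⁻ ℕ.* n) ⊗ ψ (s ^ n))
        ≈⟨ *-congʳ (inverse-^ (den-star a)) ⟩
      𝟙 ⊗ (d ^ (p⁻ ℕ.* n) ⊗ ψ (s ^ n))
        ≈⟨ *-identityˡ _ ⟩
      d ^ (p⁻ ℕ.* n) ⊗ ψ (s ^ n) ∎)
      where
      n = suc ν
      d = den a
      s = star a
      D = starFree-den A
      inverse-^ : ∀ {x y} → x ⊗ y ≈ 𝟙 → x ^ n ⊗ y ^ n ≈ 𝟙
      inverse-^ {x} {y} xy≈1 = trans (sym (^-distrib-* x y n)) (trans (^-congˡ n xy≈1) (𝟙^n n))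
      ψd^n⊗ψs^n : ψ d ^ n ⊗ ψ (s ^ n) ≈ 𝟙
      ψd^n⊗ψs^n = trans (*-congˡ (reflexive (ψ-^ s n)))
        (inverse-^ (trans (*-congʳ (ψ-den a)) (den-star _)))

    -- Denominators keep the form 1 - z d. Their constant term 1 in z makes them invertible, and the
    -- form survives products and stars.
    Fraction : Expr → Set (v ⊔ ℓ)
    Fraction a = ∃₂ λ q d → StarFree q ∧ StarFree d ∧ a ≈ q ⊗ star d

    starFree⇒fraction : ∀ {a} → StarFree a → Fraction a
    starFree⇒fraction {a} A = a , 𝟘 , A , 𝟘 , sym (trans (*-congˡ star-𝟘) (*-identityʳ a))

    -- (1 − z a)(1 − z b) = 1 − z (a + b − z a b)
    star-⊗ : ∀ a b → star a ⊗ star b ≈ star (a ⊕ b ⊕ -1ᵉ ⊗ (z ⊗ a ⊗ b))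
    star-⊗ a b = begin
      star a ⊗ star b
        ≈⟨ *-identityʳ _ ⟨
      star a ⊗ star b ⊗ 𝟙
        ≈⟨ *-congˡ (den-star c) ⟨
      star a ⊗ star b ⊗ (den c ⊗ star c)
        ≈⟨ *-congˡ (*-congʳ (solve 4 (λ m z a b → con 1 :+ m :* (z :* (a :+ b :+ m :* (z :* a :* b)))
             := (con 1 :+ m :* (z :* a)) :* (con 1 :+ m :* (z :* b))) refl -1ᵉ z a b)) ⟩
      star a ⊗ star b ⊗ (den a ⊗ den b ⊗ star c)
        ≈⟨ solve 5 (λ s t x y r → s :* t :* (x :* y :* r) := (x :* s) :* (y :* t) :* r)
             refl (star a) (star b) (den a) (den b) (star c) ⟩
      (den a ⊗ star a) ⊗ (den b ⊗ star b) ⊗ star c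
        ≈⟨ *-congʳ (*-cong (den-star a) (den-star b)) ⟩
      𝟙 ⊗ 𝟙 ⊗ star c
        ≈⟨ trans (*-congʳ (*-identityˡ 𝟙)) (*-identityˡ _) ⟩
      star c ∎
      where
      c = a ⊕ b ⊕ -1ᵉ ⊗ (z ⊗ a ⊗ b)

    fraction : ∀ a → Fraction a
    fraction 𝟘        = starFree⇒fraction 𝟘
    fraction 𝟙        = starFree⇒fraction 𝟙
    fraction z        = starFree⇒fraction z
    fraction (u d)    = starFree⇒fraction (u d)
    fraction (a ⊕ b) with fraction a | fraction b
    ... | q , d , Q , D , eq | r , e , R , E , eq′ = _ , _ ,
      Q ⊗ starFree-den E ⊕ R ⊗ starFree-den D , D ⊕ E ⊕ starFree-· 𝟙 ν ⊗ (z ⊗ D ⊗ E) , (begin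
        a ⊕ b
          ≈⟨ +-cong eq eq′ ⟩
        q ⊗ star d ⊕ r ⊗ star e
          ≈⟨ +-cong (trans (sym (*-identityʳ _)) (*-congˡ (sym (den-star e))))
                    (trans (sym (*-identityʳ _)) (*-congˡ (sym (den-star d)))) ⟩
        q ⊗ star d ⊗ (den e ⊗ star e) ⊕ r ⊗ star e ⊗ (den d ⊗ star d)
          ≈⟨ solve 6 (λ q r s t x y → q :* s :* (y :* t) :+ r :* t :* (x :* s)
                  := (q :* y :+ r :* x) :* (s :* t))
               refl q r (star d) (star e) (den d) (den e) ⟩
        (q ⊗ den e ⊕ r ⊗ den d) ⊗ (star d ⊗ star e)
          ≈⟨ *-congˡ (star-⊗ d e) ⟩
        (q ⊗ den e ⊕ r ⊗ den d) ⊗ star _ ∎)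
    fraction (a ⊗ b) with fraction a | fraction b
    ... | q , d , Q , D , eq | r , e , R , E , eq′ = _ , _ ,
      Q ⊗ R , D ⊕ E ⊕ starFree-· 𝟙 ν ⊗ (z ⊗ D ⊗ E) ,
      trans (*-cong eq eq′) (trans
        (solve 4 (λ q r s t → q :* s :* (r :* t) := q :* r :* (s :* t)) refl q r (star d) (star e))
        (*-congˡ (star-⊗ d e)))
    fraction (star a) with fraction a
    -- This is 1 / (1 - z q / (1 - z d)) = (1 - z d) / (1 - z (q + d)), with the numerator written
    -- as (1 - z (q + d)) + z q.
    ... | q , d , Q , D , eq = _ , _ , starFree-den (Q ⊕ D) ⊕ z ⊗ Q , Q ⊕ D , (begin
      star a
        ≈⟨ trans (star-cong eq) (star-⊗-star q d) ⟩
      𝟙 ⊕ z ⊗ q ⊗ star (q ⊕ d)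
        ≈⟨ +-congʳ (den-star (q ⊕ d)) ⟨
      den (q ⊕ d) ⊗ star (q ⊕ d) ⊕ z ⊗ q ⊗ star (q ⊕ d)
        ≈⟨ distribʳ _ _ _ ⟨
      (den (q ⊕ d) ⊕ z ⊗ q) ⊗ star (q ⊕ d) ∎)

    -- Extending the fraction by `den d ^ ν` makes its denominator a power with exponent pᵉ, the
    -- form that `star-selfSimilar` handles.
    decompose : ∀ a → Decomposable a
    decompose a with fraction a
    ... | q , d , Q , D , eq = _ ,
      add (Q ⊗ starFree-^ (starFree-den D) ν) (star-selfSimilar D) 𝟘 , (begin
        a
          ≈⟨ eq ⟩
        q ⊗ star d
          ≈⟨ *-identityʳ _ ⟨
        q ⊗ star d ⊗ 𝟙
          ≈⟨ *-congˡ (cancel ν) ⟨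
        q ⊗ star d ⊗ (den d ^ ν ⊗ star d ^ ν)
          ≈⟨ solve 4 (λ q s x y → q :* s :* (x :* y) := q :* x :* (s :* y) :+ con 0)
               refl q (star d) (den d ^ ν) (star d ^ ν) ⟩
        q ⊗ den d ^ ν ⊗ star d ^ suc ν ⊕ 𝟘 ∎)
      where
      cancel : ∀ n → den d ^ n ⊗ star d ^ n ≈ 𝟙
      cancel zero    = *-identityˡ 𝟙
      cancel (suc n) = trans
        (solve 4 (λ a b c e → a :* b :* (c :* e) := a :* c :* (b :* e))
             refl (den d) (den d ^ n) (star d) (star d ^ n))
        (trans (*-cong (den-star d) (cancel n)) (*-identityˡ 𝟙))

-- Saturating coefficients

module Threshold (V : CommutativeMonoid v ℓ) (p⁻ t : ℕ) where
  open Action V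
  open Frobenius V p⁻
  open CommutativeSemiring exprs hiding (zero)
  open import Relation.Binary.Reasoning.Setoid setoid

  module Saturated (saturated : ∀ x → suc t V.· x V.≈ t V.· x) where

    saturatedᵉ : ∀ a → suc t · a ≈ t · a
    saturatedᵉ a = mk λ X j i →
      V.trans (⟦·⟧ (suc t) a X j i) (V.trans (saturated _) (V.sym (⟦·⟧ t a X j i)))

    -- Powers of (z a)⋆ stabilise: their coefficients in positive degrees
    -- tend to infinity, hence reach the threshold.
    module StarPowers (a : Expr) where
      -- `U` is x⋆ with every occurring coefficient raised to the threshold. `J` is the value at
      -- which the powers of x⋆ settle: the term 1 remains single and all positive powers of x are
      -- saturated.
      x X U J : Expr
      x = z ⊗ a
      X = star a
      U = t · X
      J = 𝟙 ⊕ x ⊗ U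

      -- A substitute for an order: `U` is already saturated wherever `b` has a coefficient.
      Absorbed : Expr → Set (v ⊔ ℓ)
      Absorbed b = U ⊕ b ≈ U

      absorbed-⊕ : ∀ {b c} → Absorbed b → Absorbed c → Absorbed (b ⊕ c)
      absorbed-⊕ b≤U c≤U = trans (sym (+-assoc _ _ _)) (trans (+-congʳ b≤U) c≤U)

      absorbed-· : ∀ n {b} → Absorbed b → Absorbed (n · b)
      absorbed-· zero    b≤U = +-identityʳ U
      absorbed-· (suc n) b≤U = absorbed-⊕ b≤U (absorbed-· n b≤U)

      U-unfold : U ≈ t · 𝟙 ⊕ x ⊗ U
      U-unfold = trans (×-congʳ t (star-unfold a)) (trans (×-distrib-+ _ _ t)
        (+-congˡ (sym (×-comm-* t x X))))

      absorbed-x⊗ : ∀ {b} → Absorbed b → Absorbed (x ⊗ b)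
      absorbed-x⊗ {b} b≤U = begin
        U ⊕ x ⊗ b                    ≈⟨ +-congʳ U-unfold ⟩
        t · 𝟙 ⊕ x ⊗ U ⊕ x ⊗ b        ≈⟨ trans (+-assoc _ _ _) (+-congˡ (sym (distribˡ x U b))) ⟩
        t · 𝟙 ⊕ x ⊗ (U ⊕ b)          ≈⟨ +-congˡ (*-congˡ b≤U) ⟩
        t · 𝟙 ⊕ x ⊗ U                ≈⟨ U-unfold ⟨
        U                            ∎

      X-absorbed : Absorbed X
      X-absorbed = trans (+-comm U X) (saturatedᵉ X)

      -- `U` absorbs x U, so it solves c = U + x c, whose only solution is x⋆ U.
      X⊗U : X ⊗ U ≈ U
      X⊗U = sym (star-unique a (sym (absorbed-x⊗ (absorbed-· t X-absorbed))))

      absorbed-X⊗ : ∀ {b} → Absorbed b → Absorbed (X ⊗ b)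
      absorbed-X⊗ {b} b≤U = begin
        U ⊕ X ⊗ b     ≈⟨ +-congʳ X⊗U ⟨
        X ⊗ U ⊕ X ⊗ b ≈⟨ distribˡ X U b ⟨
        X ⊗ (U ⊕ b)   ≈⟨ *-congˡ b≤U ⟩
        X ⊗ U         ≈⟨ X⊗U ⟩
        U             ∎

      -- The coefficient of a positive power of x in (x⋆)ⁿ is at least n. The n guaranteed copies
      -- are split off and the excess goes into `s`; for n = t the copies form `U`, which swallows
      -- the excess.
      X^n : ∀ n → ∃ λ s → Absorbed s ∧ X ^ n ≈ 𝟙 ⊕ x ⊗ (n · X ⊕ s)
      X^n zero    = 𝟘 , +-identityʳ U ,
        sym (trans (+-congˡ (trans (*-congˡ (+-identityˡ 𝟘)) (zeroʳ x))) (+-identityʳ 𝟙))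
      X^n (suc n) with X^n n
      ... | s , s≤U , eq = n · (X ⊗ (x ⊗ X)) ⊕ X ⊗ s ,
        absorbed-⊕ (absorbed-· n (absorbed-X⊗ (absorbed-x⊗ X-absorbed))) (absorbed-X⊗ s≤U) , (begin
          X ⊗ X ^ n
            ≈⟨ *-congˡ eq ⟩
          X ⊗ (𝟙 ⊕ x ⊗ (n · X ⊕ s))
            ≈⟨ solve 4 (λ X x n s → X :* (con 1 :+ x :* (n :+ s)) := X :+ x :* (X :* n :+ X :* s))
                 refl X x (n · X) s ⟩
          X ⊕ x ⊗ (X ⊗ n · X ⊕ X ⊗ s)
            ≈⟨ +-cong (star-unfold a) (*-congˡ (+-congʳ X⊗nX)) ⟩
          𝟙 ⊕ x ⊗ X ⊕ x ⊗ (n · X ⊕ n · (X ⊗ (x ⊗ X)) ⊕ X ⊗ s)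
            ≈⟨ solve 5 (λ X x n y s → con 1 :+ x :* X :+ x :* (n :+ y :+ s)
                    := con 1 :+ x :* (X :+ n :+ (y :+ s)))
                 refl X x (n · X) _ (X ⊗ s) ⟩
          𝟙 ⊕ x ⊗ (X ⊕ n · X ⊕ (n · (X ⊗ (x ⊗ X)) ⊕ X ⊗ s)) ∎)
        where
        X⊗nX : X ⊗ n · X ≈ n · X ⊕ n · (X ⊗ (x ⊗ X))
        X⊗nX = begin
          X ⊗ n · X                      ≈⟨ ×-comm-* n X X ⟩
          n · (X ⊗ X)                    ≈⟨ ×-congʳ n (*-congˡ (star-unfold a)) ⟩
          n · (X ⊗ (𝟙 ⊕ x ⊗ X))          ≈⟨ ×-congʳ n (trans (distribˡ X 𝟙 _) (+-congʳ (*-identityʳ X))) ⟩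
          n · (X ⊕ X ⊗ (x ⊗ X))          ≈⟨ ×-distrib-+ _ _ n ⟩
          n · X ⊕ n · (X ⊗ (x ⊗ X))      ∎

      X^t : X ^ t ≈ J
      X^t with X^n t
      ... | s , s≤U , eq = trans eq (+-congˡ (*-congˡ s≤U))

      X⊗J : X ⊗ J ≈ J
      X⊗J = begin
        X ⊗ (𝟙 ⊕ x ⊗ U)           ≈⟨ solve 3 (λ X x U → X :* (con 1 :+ x :* U) := X :+ x :* (X :* U))
             refl X x U ⟩
        X ⊕ x ⊗ (X ⊗ U)           ≈⟨ +-cong (star-unfold a) (*-congˡ X⊗U) ⟩
        𝟙 ⊕ x ⊗ X ⊕ x ⊗ U         ≈⟨ solve 3 (λ X x U → con 1 :+ x :* X :+ x :* U
                := con 1 :+ x :* (U :+ X))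
             refl X x U ⟩
        𝟙 ⊕ x ⊗ (U ⊕ X)           ≈⟨ +-congˡ (*-congˡ X-absorbed) ⟩
        𝟙 ⊕ x ⊗ U                 ∎

      -- (x + y)⋆ = Σ_{n<t} yⁿ Xⁿ⁺¹ + yᵗ Y J with X = x⋆, Y = y⋆.
      module Sum (b : Expr) where
        y Y : Expr
        y = z ⊗ b
        Y = star b

        -- The series (x + y)⋆ solves r = X + X y r. `R` and `S` iterate the right-hand side from
        -- the guesses Y J and 0; the first guess anticipates that high powers of X have become J.
        R S : ℕ → Expr
        R zero    = Y ⊗ J
        R (suc n) = X ⊕ X ⊗ y ⊗ R n
        S zero    = 𝟘
        S (suc n) = X ⊕ X ⊗ y ⊗ S n

        S-last : ∀ n → S (suc n) ≈ S n ⊕ y ^ n ⊗ X ^ suc n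
        S-last zero    = solve 2 (λ X y → X :+ X :* y :* con 0 := con 0 :+ con 1 :* (X :* con 1))
             refl X y
        S-last (suc n) = trans (+-congˡ (*-congˡ (S-last n)))
          (solve 5 (λ X y s p q → X :+ X :* y :* (s :+ p :* q) := X :+ X :* y :* s :+ y :* p :* (X :* q))
            refl X y (S n) (y ^ n) (X ^ suc n))

        R≈S : ∀ n → R n ≈ S n ⊕ y ^ n ⊗ R 0
        R≈S zero    = sym (trans (+-identityˡ _) (*-identityˡ _))
        R≈S (suc n) = begin
          X ⊕ X ⊗ y ⊗ R n
            ≈⟨ +-congˡ (*-congˡ (R≈S n)) ⟩
          X ⊕ X ⊗ y ⊗ (S n ⊕ y ^ n ⊗ (Y ⊗ J))
            ≈⟨ solve 6 (λ X y s p Y J → X :+ X :* y :* (s :+ p :* (Y :* J)) := X :+ X :* y :* s :+ y :* p :* (Y :* (X :* J)))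
                 refl X y (S n) (y ^ n) Y J ⟩
          X ⊕ X ⊗ y ⊗ S n ⊕ y ⊗ y ^ n ⊗ (Y ⊗ (X ⊗ J))
            ≈⟨ +-congˡ (*-congˡ (*-congˡ X⊗J)) ⟩
          X ⊕ X ⊗ y ⊗ S n ⊕ y ⊗ y ^ n ⊗ (Y ⊗ J) ∎

        -- The next iteration adds yᵗ Xᵗ⁺¹ = yᵗ J and multiplies the tail yᵗ Y J by y. These
        -- balance, because J + y Y J = Y J.
        R-fixed : R t ≈ R (suc t)
        R-fixed = sym (begin
          R (suc t)
            ≈⟨ R≈S (suc t) ⟩
          S (suc t) ⊕ y ^ suc t ⊗ (Y ⊗ J)
            ≈⟨ +-congʳ (S-last t) ⟩
          S t ⊕ y ^ t ⊗ (X ⊗ X ^ t) ⊕ y ^ suc t ⊗ (Y ⊗ J)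
            ≈⟨ +-congʳ (+-congˡ (*-congˡ (trans (*-congˡ X^t) X⊗J))) ⟩
          S t ⊕ y ^ t ⊗ J ⊕ y ^ suc t ⊗ (Y ⊗ J)
            ≈⟨ solve 5 (λ s p J y Y → s :+ p :* J :+ y :* p :* (Y :* J) := s :+ p :* ((con 1 :+ y :* Y) :* J))
                 refl (S t) (y ^ t) J y Y ⟩
          S t ⊕ y ^ t ⊗ ((𝟙 ⊕ y ⊗ Y) ⊗ J)
            ≈⟨ +-congˡ (*-congˡ (*-congʳ (star-unfold b))) ⟨
          S t ⊕ y ^ t ⊗ (Y ⊗ J)
            ≈⟨ R≈S t ⟨
          R t ∎)

        star-⊕ : star (a ⊕ b) ≈ R t
        star-⊕ = sym (trans (star-unique (a ⊕ b) (begin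
          R t
            ≈⟨ Rt≈ ⟩
          X ⊗ (𝟙 ⊕ y ⊗ R t)
            ≈⟨ *-congʳ (star-unfold a) ⟩
          (𝟙 ⊕ x ⊗ X) ⊗ (𝟙 ⊕ y ⊗ R t)
            ≈⟨ solve 3 (λ x X r → (con 1 :+ x :* X) :* r := r :+ x :* (X :* r)) refl x X _ ⟩
          𝟙 ⊕ y ⊗ R t ⊕ x ⊗ (X ⊗ (𝟙 ⊕ y ⊗ R t))
            ≈⟨ +-congˡ (*-congˡ Rt≈) ⟨
          𝟙 ⊕ y ⊗ R t ⊕ x ⊗ R t
            ≈⟨ solve 4 (λ z a b r → con 1 :+ z :* b :* r :+ z :* a :* r := con 1 :+ z :* (a :+ b) :* r)
                 refl z a b (R t) ⟩
          𝟙 ⊕ z ⊗ (a ⊕ b) ⊗ R t ∎)) (*-identityʳ _))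
          where
          Rt≈ : R t ≈ X ⊗ (𝟙 ⊕ y ⊗ R t)
          Rt≈ = trans R-fixed
            (solve 3 (λ X y r → X :+ X :* y :* r := X :* (con 1 :+ y :* r)) refl X y (R t))

    data Term : Expr → Set where
      mono : ∀ {m} → Monomial m → Term m
      _⊛_  : ∀ {a h} → Term a → Monomial h → Term (a ⊗ star h)

    data Terms : Expr → Set where
      𝟘   : Terms 𝟘
      _⊕_ : ∀ {a b} → Term a → Terms b → Terms (a ⊕ b)

    SemiSimple : Expr → Set (v ⊔ ℓ)
    SemiSimple a = ∃ λ b → Terms b ∧ a ≈ b

    ss-resp : ∀ {a b} → a ≈ b → SemiSimple b → SemiSimple a
    ss-resp a≈b (c , C , b≈c) = c , C , trans a≈b b≈c

    ss-term : ∀ {a} → Term a → SemiSimple a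
    ss-term A = _ , A ⊕ 𝟘 , sym (+-identityʳ _)

    ss-mono : ∀ {a} → Monomial a → SemiSimple a
    ss-mono A = ss-term (mono A)

    terms-⊕ : ∀ {a b} → Terms a → SemiSimple b → SemiSimple (a ⊕ b)
    terms-⊕ 𝟘        B = ss-resp (+-identityˡ _) B
    terms-⊕ (A ⊕ As) B with terms-⊕ As B
    ... | c , C , eq = _ , A ⊕ C , trans (+-assoc _ _ _) (+-congˡ eq)

    ss-⊕ : ∀ {a b} → SemiSimple a → SemiSimple b → SemiSimple (a ⊕ b)
    ss-⊕ (_ , A , a≈) B = ss-resp (+-congʳ a≈) (terms-⊕ A B)

    term-⊗-mono : ∀ {a b} → Term a → Monomial b → ∃ λ c → Term c ∧ a ⊗ b ≈ c
    term-⊗-mono (mono m) k = _ , mono (m ⊗ k) , refl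
    term-⊗-mono {b = b} (_⊛_ {a} {h} A H) k with term-⊗-mono A k
    ... | c , C , eq = _ , C ⊛ H , trans
      (solve 3 (λ a h b → a :* h :* b := a :* b :* h) refl a (star h) b) (*-congʳ eq)

    term-⊗ : ∀ {a b} → Term a → Term b → ∃ λ c → Term c ∧ a ⊗ b ≈ c
    term-⊗ A (mono k) = term-⊗-mono A k
    term-⊗ A (B ⊛ H) with term-⊗ A B
    ... | c , C , eq = _ , C ⊛ H , trans (sym (*-assoc _ _ _)) (*-congʳ eq)

    ss-term-⊗ : ∀ {a b} → Term a → Terms b → SemiSimple (a ⊗ b)
    ss-term-⊗ A 𝟘       = _ , 𝟘 , zeroʳ _
    ss-term-⊗ A (B ⊕ C) with term-⊗ A B
    ... | _ , D , eq = ss-resp (distribˡ _ _ _) (ss-⊕ (ss-resp eq (ss-term D)) (ss-term-⊗ A C))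

    terms-⊗ : ∀ {a b} → Terms a → Terms b → SemiSimple (a ⊗ b)
    terms-⊗ 𝟘        B = _ , 𝟘 , zeroˡ _
    terms-⊗ (A ⊕ As) B = ss-resp (distribʳ _ _ _) (ss-⊕ (ss-term-⊗ A B) (terms-⊗ As B))

    ss-⊗ : ∀ {a b} → SemiSimple a → SemiSimple b → SemiSimple (a ⊗ b)
    ss-⊗ (_ , A , a≈) (_ , B , b≈) = ss-resp (*-cong a≈ b≈) (terms-⊗ A B)

    ss-· : ∀ {a} → SemiSimple a → ∀ n → SemiSimple (n · a)
    ss-· A zero    = _ , 𝟘 , refl
    ss-· A (suc n) = ss-⊕ A (ss-· A n)

    ss-star-⊕ : ∀ {a b} → SemiSimple a → SemiSimple b → SemiSimple (star a) → SemiSimple (star b) →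
                SemiSimple (star (a ⊕ b))
    ss-star-⊕ {a} {b} A B A⋆ B⋆ = ss-resp star-⊕ (ss-R t)
      where
      open StarPowers a
      open Sum b
      ss-R : ∀ n → SemiSimple (R n)
      ss-R zero    = ss-⊗ B⋆ (ss-⊕ (ss-mono 𝟙) (ss-⊗ (ss-⊗ (ss-mono z) A) (ss-· A⋆ t)))
      ss-R (suc n) = ss-⊕ A⋆ (ss-⊗ (ss-⊗ A⋆ (ss-⊗ (ss-mono z) B)) (ss-R n))

    ss-star-mono : ∀ {h} → Monomial h → SemiSimple (star h)
    ss-star-mono H = ss-resp (sym (*-identityˡ _)) (ss-term (mono 𝟙 ⊛ H))

    -- Denesting trades a starred factor of the term for a summand under the outer star, so the
    -- recursion runs on the number of starred factors.
    ss-star-term : ∀ {a} → Term a → SemiSimple (star a)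
    ss-star-term (mono m) = ss-star-mono m
    ss-star-term (A ⊛ H)  = ss-resp (star-⊗-star _ _)
      (ss-⊕ (ss-mono 𝟙) (ss-⊗ (ss-⊗ (ss-mono z) (ss-term A))
        (ss-star-⊕ (ss-term A) (ss-mono H) (ss-star-term A) (ss-star-mono H))))

    ss-star : ∀ {a} → Terms a → SemiSimple (star a)
    ss-star 𝟘        = ss-resp star-𝟘 (ss-mono 𝟙)
    ss-star (A ⊕ As) = ss-star-⊕ (ss-term A) (_ , As , refl) (ss-star-term A) (ss-star As)

    semiSimple : ∀ a → SemiSimple a
    semiSimple 𝟘        = _ , 𝟘 , refl
    semiSimple 𝟙        = ss-mono 𝟙
    semiSimple z        = ss-mono z
    semiSimple (u d)    = ss-mono (u d)
    semiSimple (a ⊕ b)  = ss-⊕ (semiSimple a) (semiSimple b)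
    semiSimple (a ⊗ b)  = ss-⊗ (semiSimple a) (semiSimple b)
    semiSimple (star a) with semiSimple a
    ... | b , B , a≈b = ss-resp (star-cong a≈b) (ss-star B)

    geometric : Expr → ℕ → Expr
    geometric x zero    = 𝟘
    geometric x (suc n) = 𝟙 ⊕ x ⊗ geometric x n

    geometric-last : ∀ x n → geometric x (suc n) ≈ geometric x n ⊕ x ^ n
    geometric-last x zero    = trans (+-congˡ (zeroʳ x)) (+-comm 𝟙 𝟘)
    geometric-last x (suc n) = trans (+-congˡ (*-congˡ (geometric-last x n)))
      (solve 3 (λ x g y → con 1 :+ x :* (g :+ y) := con 1 :+ x :* g :+ x :* y) refl x _ _)

    starFree-geometric : ∀ {a} → StarFree a → ∀ n → StarFree (geometric a n)
    starFree-geometric A zero    = 𝟘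
    starFree-geometric A (suc n) = 𝟙 ⊕ A ⊗ starFree-geometric A n

    -- x⋆ = (1 + x + ⋯ + xᵖ⁻¹)(xᵖ)⋆
    star-selfSimilar : ∀ {h} → Monomial h → SelfSimilar (star h)
    star-selfSimilar {h} H = G p , starFree-geometric (z ⊗ monomial⇒starFree H) p ,
      sym (trans (star-unique h (begin
        G p ⊗ s
          ≈⟨ solve 3 (λ x g s → (con 1 :+ x :* g) :* s := s :+ x :* g :* s) refl x (G p⁻) s ⟩
        s ⊕ x ⊗ G p⁻ ⊗ s
          ≈⟨ +-congʳ s-unfold ⟩
        𝟙 ⊕ x ^ p ⊗ s ⊕ x ⊗ G p⁻ ⊗ s
          ≈⟨ solve 4 (λ x y g s → con 1 :+ x :* y :* s :+ x :* g :* s := con 1 :+ x :* ((g :+ y) :* s))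
               refl x (x ^ p⁻) (G p⁻) s ⟩
        𝟙 ⊕ x ⊗ ((G p⁻ ⊕ x ^ p⁻) ⊗ s)
          ≈⟨ +-congˡ (*-congˡ (*-congʳ (geometric-last x p⁻))) ⟨
        𝟙 ⊕ x ⊗ (G p ⊗ s) ∎)) (*-identityʳ _))
      where
      x = z ⊗ h
      G = geometric x
      s = ψ (star h)
      s-unfold : s ≈ 𝟙 ⊕ x ^ p ⊗ s
      s-unfold = trans (star-unfold _) (+-congˡ (*-congʳ (begin
        z ⊗ (z ^ p⁻ ⊗ ψ h)  ≈⟨ *-assoc z _ _ ⟨
        z ^ p ⊗ ψ h         ≈⟨ *-congˡ (monomial-ψ H) ⟩
        z ^ p ⊗ h ^ p       ≈⟨ ^-distrib-* z h p ⟨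
        x ^ p               ∎)))

    selfSimilar-⊗ : ∀ {a b} → SelfSimilar a → SelfSimilar b → SelfSimilar (a ⊗ b)
    selfSimilar-⊗ {a} {b} (q , Q , eq) (r , R , eq′) = q ⊗ r , Q ⊗ R , trans (*-cong eq eq′)
      (solve 4 (λ q a r b → q :* a :* (r :* b) := q :* r :* (a :* b)) refl q (ψ a) r (ψ b))

    term-decompose : ∀ {a} → Term a → ∃₂ λ q d → StarFree q ∧ SelfSimilar d ∧ a ≈ q ⊗ d
    term-decompose (mono {m} M) = m , 𝟙 , monomial⇒starFree M , (𝟙 , 𝟙 , sym (*-identityʳ 𝟙)) , sym (*-identityʳ _)
    term-decompose (_⊛_ {h = h} A H) with term-decompose A
    ... | q , d , Q , D , a≈ = q , d ⊗ star h , Q , selfSimilar-⊗ D (star-selfSimilar H) ,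
      trans (*-congʳ a≈) (*-assoc _ _ _)

    terms-decompose : ∀ {a} → Terms a → Decomposable a
    terms-decompose 𝟘        = 𝟘 , 𝟘 , refl
    terms-decompose (A ⊕ As) with term-decompose A | terms-decompose As
    ... | q , d , Q , D , a≈ | b , B , as≈ = _ , add Q D B , +-cong a≈ as≈

    decompose : ∀ a → Decomposable a
    decompose a with semiSimple a
    ... | b , B , a≈b with terms-decompose B
    ...   | c , C , b≈c = c , C , trans a≈b b≈c

-- Elimination

module Elimination (V : CommutativeMonoid v ℓ) where
  open Action V
  open import Algebra.Properties.CommutativeMonoid.Sum Diagram using (sum; sum-cong-≋; ∑-distrib-+)
  open import Algebra.Solver.CommutativeMonoid Diagram
    using () renaming (solve to solveʷ; _⊕_ to _:+_; _⊜_ to _:=_)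
  open import Relation.Binary.Reasoning.Setoid W.setoid

  combination : ∀ {n} → (Fin n → Expr) → (Fin n → W) → W
  combination A X = sum (λ i → ⟦ A i ⟧ (X i))

  ⟦⟧-combination : ∀ a {n} (A : Fin n → Expr) X →
                   ⟦ a ⟧ (combination A X) ≋ combination (λ i → a ⊗ A i) X
  ⟦⟧-combination a {zero}  A X = ⟦⟧-0 a
  ⟦⟧-combination a {suc n} A X = W.trans (⟦⟧-+ a _ _)
    (W.∙-cong W.refl (⟦⟧-combination a (A ∘ suc) (X ∘ suc)))

  combination-⊕ : ∀ {n} (A B : Fin n → Expr) X →
                  combination (λ i → A i ⊕ B i) X ≋ combination A X +ʷ combination B X
  combination-⊕ {n} A B X = ∑-distrib-+ {n} (λ i → ⟦ A i ⟧ (X i)) (λ i → ⟦ B i ⟧ (X i))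

  combination-𝟘 : ∀ {n} (X : Fin n → W) → 0ʷ ≋ combination (λ _ → 𝟘) X
  combination-𝟘 {zero}  X = W.refl
  combination-𝟘 {suc n} X = W.trans (combination-𝟘 (X ∘ suc)) (W.sym (W.identityˡ _))

  module _ {m} (E : Fin m → W) where

    -- Elimination alters the inhomogeneous parts. Asking only that they be combinations of fixed
    -- generators gives a hypothesis that survives the induction.
    Spanned : W → Set _
    Spanned X = ∃ λ G → X ≋ combination G E

    spanned-resp : ∀ {X Y} → X ≋ Y → Spanned Y → Spanned X
    spanned-resp X≋Y (G , eq) = G , W.trans X≋Y eq

    spanned-+ : ∀ {X Y} → Spanned X → Spanned Y → Spanned (X +ʷ Y)
    spanned-+ (G , eq) (H , eq′) = (λ i → G i ⊕ H i) ,
      W.trans (W.∙-cong eq eq′) (W.sym (combination-⊕ G H E))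

    spanned-⟦⟧ : ∀ a {X} → Spanned X → Spanned (⟦ a ⟧ X)
    spanned-⟦⟧ a (G , eq) = (λ i → a ⊗ G i) , W.trans (⟦⟧-cong a eq) (⟦⟧-combination a G E)

    spanned-combination : ∀ {n} (A : Fin n → Expr) {X : Fin n → W} →
                          (∀ i → Spanned (X i)) → Spanned (combination A X)
    spanned-combination {zero}  A Xs = (λ _ → 𝟘) , combination-𝟘 E
    spanned-combination {suc n} A Xs =
      spanned-+ (spanned-⟦⟧ (A zero) (Xs zero)) (spanned-combination (A ∘ suc) (Xs ∘ suc))

    -- Gaussian elimination: the first equation is solved for its own unknown by a star, and the
    -- solution is substituted into the others.
    eliminate : ∀ {n} (A : Fin n → Fin n → Expr) (B X : Fin n → W) → (∀ y → Spanned (B y)) →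
                (∀ y → X y ≋ B y +ʷ combination (λ x → z ⊗ A y x) X) → ∀ y → Spanned (X y)
    eliminate {zero}  A B X Bs eq ()
    eliminate {suc n} A B X Bs eq = spanned
      where
      a₀ = star (A zero zero)
      C : Fin (suc n) → W
      C y = combination (λ x → z ⊗ A y (suc x)) (X ∘ suc)
      X₀ : X zero ≋ ⟦ a₀ ⟧ (B zero +ʷ C zero)
      X₀ = star-uniqueʷ (A zero zero) (W.trans (eq zero)
        (solveʷ 3 (λ b x c → b :+ (x :+ c) := (b :+ c) :+ x) W.refl (B zero) _ (C zero)))
      -- The substitution produces two factors z. One stays in front of the whole coefficient, so
      -- the smaller system has the same form and its stars are again defined.
      A′ : Fin n → Fin n → Expr
      A′ y x = A (suc y) (suc x) ⊕ A (suc y) zero ⊗ (a₀ ⊗ (z ⊗ A zero (suc x)))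
      k : Fin n → Expr
      k y = z ⊗ A (suc y) zero ⊗ a₀
      B′ : Fin n → W
      B′ y = B (suc y) +ʷ ⟦ k y ⟧ (B zero)
      eq′ : ∀ y → X (suc y) ≋ B′ y +ʷ combination (λ x → z ⊗ A′ y x) (X ∘ suc)
      eq′ y = begin
        X (suc y)
          ≈⟨ eq (suc y) ⟩
        B (suc y) +ʷ (⟦ z ⊗ A (suc y) zero ⟧ (X zero) +ʷ C (suc y))
          ≈⟨ W.∙-cong W.refl (W.∙-cong (⟦⟧-cong (z ⊗ A (suc y) zero) X₀) W.refl) ⟩
        B (suc y) +ʷ (⟦ k y ⟧ (B zero +ʷ C zero) +ʷ C (suc y))
          ≈⟨ W.∙-cong W.refl (W.∙-cong (⟦⟧-+ (k y) _ _) W.refl) ⟩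
        B (suc y) +ʷ (⟦ k y ⟧ (B zero) +ʷ ⟦ k y ⟧ (C zero) +ʷ C (suc y))
          ≈⟨ solveʷ 4 (λ b x y c → b :+ ((x :+ y) :+ c) := (b :+ x) :+ (c :+ y)) W.refl (B (suc y)) _ _ (C (suc y)) ⟩
        B′ y +ʷ (C (suc y) +ʷ ⟦ k y ⟧ (C zero))
          ≈⟨ W.∙-cong W.refl (W.∙-cong W.refl (⟦⟧-combination (k y) (λ x → z ⊗ A zero (suc x)) (X ∘ suc))) ⟩
        B′ y +ʷ (C (suc y) +ʷ combination (λ x → k y ⊗ (z ⊗ A zero (suc x))) (X ∘ suc))
          ≈⟨ W.∙-cong W.refl (W.sym (combination-⊕ (λ x → z ⊗ A (suc y) (suc x))
               (λ x → k y ⊗ (z ⊗ A zero (suc x))) (X ∘ suc))) ⟩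
        B′ y +ʷ combination (λ x → z ⊗ A (suc y) (suc x) ⊕ k y ⊗ (z ⊗ A zero (suc x))) (X ∘ suc)
          ≈⟨ W.∙-cong W.refl (sum-cong-≋ {n} λ x → W.sym (⟦⟧-+ z (⟦ A (suc y) (suc x) ⟧ (X (suc x)))
               (⟦ A (suc y) zero ⊗ (a₀ ⊗ (z ⊗ A zero (suc x))) ⟧ (X (suc x))))) ⟩
        B′ y +ʷ combination (λ x → z ⊗ A′ y x) (X ∘ suc) ∎
      spanned⁺ : ∀ y → Spanned (X (suc y))
      spanned⁺ = eliminate A′ B′ (X ∘ suc)
        (λ y → spanned-+ (Bs (suc y)) (spanned-⟦⟧ (k y) (Bs zero))) eq′
      spanned : ∀ y → Spanned (X y)
      spanned zero    = spanned-resp X₀ (spanned-⟦⟧ a₀ (spanned-+ (Bs zero)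
        (spanned-combination (λ x → z ⊗ A zero (suc x)) spanned⁺)))
      spanned (suc y) = spanned⁺ y

  spanned-generator : ∀ {n} (E : Fin n → W) y → Spanned E (E y)
  spanned-generator {suc n} E zero    = 𝟙 Vector.∷ (λ _ → 𝟘) ,
    W.trans (W.sym (W.identityʳ _)) (W.∙-cong W.refl (combination-𝟘 (E ∘ suc)))
  spanned-generator {suc n} E (suc y) with spanned-generator (E ∘ suc) y
  ... | G , eq = 𝟘 Vector.∷ G , W.trans eq (W.sym (W.identityˡ _))

-- Automata

module Automata (p : ℕ) where

  infixl 6 _⟨+⟩_
  _⟨+⟩_ : ℤ → Fin p → ℤ
  i ⟨+⟩ s = + p ℤ.* i ℤ.+ + toℕ s

  -- Time is the first argument here, whereas the points of the spacetime diagram list space first.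
  Automatic : {A : Set a} → (ℤ → ℤ → A) → Set a
  Automatic {A = A} f = ∃ λ m → ∃ λ (e : ℤ → ℤ → Fin m) →
    (∃ λ (h : Fin m → A) → ∀ j i → f j i ≡ h (e j i)) ∧
    (∃ λ (g : Fin p → Fin p → Fin m → Fin m) →
       ∀ r s j i → e (j ⟨+⟩ r) (i ⟨+⟩ s) ≡ g r s (e j i))

  automatic-map : {A : Set a} {B : Set b} {f : ℤ → ℤ → A} {f′ : ℤ → ℤ → B} (k : A → B) →
                  Automatic f → (∀ j i → f′ j i ≡ k (f j i)) → Automatic f′
  automatic-map k (m , e , (h , eq) , g) eq′ =
    m , e , (k ∘ h , λ j i → ≡.trans (eq′ j i) (≡.cong k (eq j i))) , g

  automatic-const : {A : Set a} (x : A) → Automatic (λ _ _ → x)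
  automatic-const x = 1 , (λ _ _ → zero) , ((λ _ → x) , λ _ _ → ≡.refl) , ((λ _ _ s → s) , λ _ _ _ _ → ≡.refl)

  automatic-zip : {A : Set a} {B : Set b} {f : ℤ → ℤ → A} {f′ : ℤ → ℤ → B} →
                  Automatic f → Automatic f′ → Automatic (λ j i → f j i , f′ j i)
  automatic-zip (m , e , (h , f≡) , (g , step)) (m′ , e′ , (h′ , f′≡) , (g′ , step′)) =
    m ℕ.* m′ , (λ j i → combine (e j i) (e′ j i)) ,
    ((λ s → let q , r = remQuot m′ s in h q , h′ r) , λ j i →
      ≡.trans (≡.cong₂ _,_ (f≡ j i) (f′≡ j i))
        (≡.cong (λ (q , r) → h q , h′ r) (≡.sym (Fin.remQuot-combine (e j i) (e′ j i))))) ,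
    ((λ r s t → let q , q′ = remQuot m′ t in combine (g r s q) (g′ r s q′)) , λ r s j i →
      ≡.trans (≡.cong₂ combine (step r s j i) (step′ r s j i))
        (≡.cong (λ (q , q′) → combine (g r s q) (g′ r s q′)) (≡.sym (Fin.remQuot-combine (e j i) (e′ j i)))))

  automatic-tabulate : ∀ {A : Set a} {n} (f : Fin n → ℤ → ℤ → A) → (∀ y → Automatic (f y)) →
                       Automatic (λ j i → Vec.tabulate (λ y → f y j i))
  automatic-tabulate {n = zero}  f fs = automatic-const []
  automatic-tabulate {n = suc n} f fs = automatic-map (λ (x , xs) → x ∷ xs)
    (automatic-zip (fs zero) (automatic-tabulate (f ∘ suc) (fs ∘ suc))) (λ _ _ → ≡.refl)

  funToFin-cong : ∀ {m n} {f g : Fin m → Fin n} → f ≗ g → funToFin f ≡ funToFin g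
  funToFin-cong {zero}  f≗g = ≡.refl
  funToFin-cong {suc m} f≗g = ≡.cong₂ combine (f≗g zero) (funToFin-cong (f≗g ∘ suc))

  -- The values at (j , i) of a finite family of functions form the state of
  -- an automaton as soon as they determine the values at (p j + r , p i + s).
  automatic-family : ∀ {I : Set} {n} (code : I → Fin n) (index : Fin n → I) → (∀ ι → index (code ι) ≡ ι) →
    ∀ {K} (f : I → ℤ → ℤ → Fin K)
    (G : Fin p → Fin p → (I → Fin K) → I → Fin K) →
    (∀ r s {φ χ} → φ ≗ χ → G r s φ ≗ G r s χ) →
    (∀ r s j i ι → f ι (j ⟨+⟩ r) (i ⟨+⟩ s) ≡ G r s (λ κ → f κ j i) ι) →
    {A : Set a} (out : (I → Fin K) → A) → (∀ {φ χ} → φ ≗ χ → out φ ≡ out χ) →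
    Automatic (λ j i → out (λ ι → f ι j i))
  automatic-family {I = I} {n} code index inverse {K} f G G-cong step out out-cong =
    _ , e , (out ∘ decode , λ j i → out-cong (≡.sym ∘ decode-e j i)) ,
    ((λ r s → encode ∘ G r s ∘ decode) , λ r s j i → funToFin-cong λ k →
      ≡.trans (step r s j i (index k)) (G-cong r s (≡.sym ∘ decode-e j i) (index k)))
    where
    encode : (I → Fin K) → Fin (K ℕ.^ n)
    encode φ = funToFin (φ ∘ index)
    decode : Fin (K ℕ.^ n) → I → Fin K
    decode s ι = finToFun s (code ι)
    e : ℤ → ℤ → Fin (K ℕ.^ n)
    e j i = encode (λ ι → f ι j i)
    decode-e : ∀ j i ι → decode (e j i) ι ≡ f ι j i
    decode-e j i ι = ≡.trans (Fin.finToFun-funToFin (λ k → f (index k) j i) (code ι))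
      (≡.cong (λ κ → f κ j i) (inverse ι))

nonNegative : ℤ → Bool
nonNegative (+ _)    = true
nonNegative -[1+ _ ] = false

digit-+ : ∀ p j r → + p ℤ.* + j ℤ.+ + r ≡ + (p ℕ.* j ℕ.+ r)
digit-+ p j r = ≡.cong (λ i → i ℤ.+ + r) (≡.sym (ℤ.pos-* p j))

digit-- : ∀ p⁻ j {r} → r ℕ.< suc p⁻ → ∃ λ k → + suc p⁻ ℤ.* -[1+ j ] ℤ.+ + r ≡ -[1+ k ]
digit-- p⁻ j {r} r<p = m ℕ.∸ r , ≡.trans (ℤ.⊖-< (s≤s r≤m)) (≡.cong (λ n → ℤ.- + n) (ℕ.+-∸-assoc 1 r≤m))
  where
  -- This is p (j + 1) - 1, which is at least p - 1 and hence at least r; the number stays negative.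
  m = j ℕ.+ p⁻ ℕ.* suc j
  r≤m : r ℕ.≤ m
  r≤m = ℕ.≤-trans (ℕ.≤-pred r<p) (ℕ.≤-trans (ℕ.m≤m*n p⁻ (suc j)) (ℕ.m≤n+m _ j))

nonNegative-digit : ∀ p⁻ j (r : Fin (suc p⁻)) → nonNegative (Automata._⟨+⟩_ (suc p⁻) j r) ≡ nonNegative j
nonNegative-digit p⁻ (+ j) r = ≡.cong nonNegative (digit-+ (suc p⁻) j (toℕ r))
nonNegative-digit p⁻ -[1+ j ] r = ≡.cong nonNegative (proj₂ (digit-- p⁻ j (Fin.toℕ<n r)))

-- Shifts δ with ∣ δ ∣ ≤ A act on a window of offsets − A, …, A; adding a
-- base-p digit and dividing by p maps the window into itself.
module Window (k A : ℕ) where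
  p L : ℕ
  p = 2 ℕ.+ k
  L = suc (A ℕ.+ A)

  offset : Fin L → ℤ
  offset l = + toℕ l ℤ.- + A

  reflect : ℤ → ℕ
  reflect (+ n)    = A ℕ.∸ n
  reflect -[1+ n ] = A ℕ.+ suc n

  reflect-spec : ∀ δ → ℤ.∣ δ ∣ ℕ.≤ A → + reflect δ ≡ + A ℤ.- δ
  reflect-spec (+ n)    n≤A = ≡.sym (≡.trans (ℤ.m-n≡m⊖n A n) (ℤ.⊖-≥ n≤A))
  reflect-spec -[1+ n ] n<A = ≡.refl

  reflect≤ : ∀ δ → ℤ.∣ δ ∣ ℕ.≤ A → reflect δ ℕ.≤ A ℕ.+ A
  reflect≤ (+ n)    _   = ℕ.≤-trans (ℕ.m∸n≤m A n) (ℕ.m≤m+n A A)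
  reflect≤ -[1+ n ] n<A = ℕ.+-monoʳ-≤ A n<A

  -- The position of -δ in the window. Reduction modulo `L` makes this total and changes nothing
  -- when ∣ δ ∣ ≤ A.
  locate : ℤ → Fin L
  locate δ = reflect δ mod L

  offset-locate : ∀ δ → ℤ.∣ δ ∣ ℕ.≤ A → offset (locate δ) ≡ ℤ.- δ
  offset-locate δ δ≤A = begin
    + toℕ (locate δ) ℤ.- + A  ≡⟨ ≡.cong (λ n → + n ℤ.- + A) (≡.trans (Fin.toℕ-fromℕ< _) (m<n⇒m%n≡m (s≤s (reflect≤ δ δ≤A)))) ⟩
    + reflect δ ℤ.- + A       ≡⟨ ≡.cong (λ i → i ℤ.- + A) (reflect-spec δ δ≤A) ⟩
    + A ℤ.- δ ℤ.- + A         ≡⟨ lemma (+ A) δ ⟩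
    ℤ.- δ                     ∎
    where
    open ≡.≡-Reasoning
    lemma : ∀ A δ → A ℤ.- δ ℤ.- A ≡ ℤ.- δ
    lemma = ℤSolver.solve-∀

  -- This is r + offset l - δ, raised by p A to become a natural number: the offset and `reflect`
  -- account for two copies of A, and k A for the other p - 2. Division by p then raises the
  -- quotient by exactly A.
  total : Fin p → Fin L → ℤ → ℕ
  total r l δ = toℕ r ℕ.+ toℕ l ℕ.+ reflect δ ℕ.+ k ℕ.* A

  carry : Fin p → Fin L → ℤ → Fin L
  carry r l δ = (total r l δ / p) mod L

  digit : Fin p → Fin L → ℤ → Fin p
  digit r l δ = total r l δ mod p

  -- The digit is below p and the next two summands are at most 2 A each. Since p ≥ 2 there is room
  -- for all of them, so the quotient fits into the window and the reduction modulo `L` in `carry`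
  -- is harmless.
  total< : ∀ r l δ → ℤ.∣ δ ∣ ℕ.≤ A → total r l δ ℕ.< L ℕ.* p
  total< r l δ δ≤A = begin-strict
    toℕ r ℕ.+ toℕ l ℕ.+ reflect δ ℕ.+ k ℕ.* A
      <⟨ ℕ.+-monoˡ-< (k ℕ.* A) (ℕ.+-mono-<-≤ (ℕ.+-mono-<-≤ (Fin.toℕ<n r) (ℕ.≤-pred (Fin.toℕ<n l))) (reflect≤ δ δ≤A)) ⟩
    p ℕ.+ (A ℕ.+ A) ℕ.+ (A ℕ.+ A) ℕ.+ k ℕ.* A
      ≤⟨ ℕ.m≤m+n _ (k ℕ.* A) ⟩
    p ℕ.+ (A ℕ.+ A) ℕ.+ (A ℕ.+ A) ℕ.+ k ℕ.* A ℕ.+ k ℕ.* A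
      ≡⟨ lemma k A ⟩
    L ℕ.* p ∎
    where
    open ℕ.≤-Reasoning
    lemma : ∀ k A → 2 ℕ.+ k ℕ.+ (A ℕ.+ A) ℕ.+ (A ℕ.+ A) ℕ.+ k ℕ.* A ℕ.+ k ℕ.* A ≡ suc (A ℕ.+ A) ℕ.* (2 ℕ.+ k)
    lemma = ℕSolver.solve-∀

  carry-spec : ∀ r l δ → ℤ.∣ δ ∣ ℕ.≤ A →
               + toℕ r ℤ.+ offset l ℤ.- δ ≡ + p ℤ.* offset (carry r l δ) ℤ.+ + toℕ (digit r l δ)
  carry-spec r l δ δ≤A = begin
    + toℕ r ℤ.+ (+ toℕ l ℤ.- + A) ℤ.- δ
      ≡⟨ lemma₁ (+ toℕ r) (+ toℕ l) (+ A) δ (+ k) ⟩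
    + toℕ r ℤ.+ + toℕ l ℤ.+ (+ A ℤ.- δ) ℤ.+ + k ℤ.* + A ℤ.- + p ℤ.* + A
      ≡⟨ ≡.cong₂ (λ x y → + toℕ r ℤ.+ + toℕ l ℤ.+ x ℤ.+ y ℤ.- + p ℤ.* + A)
           (≡.sym (reflect-spec δ δ≤A)) (≡.sym (ℤ.pos-* k A)) ⟩
    + n ℤ.- + p ℤ.* + A
      ≡⟨ ≡.cong (λ m → + m ℤ.- + p ℤ.* + A) (m≡m%n+[m/n]*n n p) ⟩
    + (n % p) ℤ.+ + (n / p ℕ.* p) ℤ.- + p ℤ.* + A
      ≡⟨ ≡.cong (λ m → + (n % p) ℤ.+ m ℤ.- + p ℤ.* + A) (ℤ.pos-* (n / p) p) ⟩
    + (n % p) ℤ.+ + (n / p) ℤ.* + p ℤ.- + p ℤ.* + A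
      ≡⟨ lemma₂ (+ (n % p)) (+ (n / p)) (+ p) (+ A) ⟩
    + p ℤ.* (+ (n / p) ℤ.- + A) ℤ.+ + (n % p)
      ≡⟨ ≡.cong₂ (λ x y → + p ℤ.* (+ x ℤ.- + A) ℤ.+ + y)
           (≡.sym (≡.trans (Fin.toℕ-fromℕ< _) (m<n⇒m%n≡m (m<n*o⇒m/o<n {n} {L} {p} (total< r l δ δ≤A)))))
           (≡.sym (Fin.toℕ-fromℕ< _)) ⟩
    + p ℤ.* offset (carry r l δ) ℤ.+ + toℕ (digit r l δ) ∎
    where
    open ≡.≡-Reasoning
    n = total r l δ
    lemma₁ : ∀ r l A δ k → r ℤ.+ (l ℤ.- A) ℤ.- δ ≡ r ℤ.+ l ℤ.+ (A ℤ.- δ) ℤ.+ k ℤ.* A ℤ.- (+ 2 ℤ.+ k) ℤ.* A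
    lemma₁ = ℤSolver.solve-∀
    lemma₂ : ∀ x q p A → x ℤ.+ q ℤ.* p ℤ.- p ℤ.* A ≡ p ℤ.* (q ℤ.- A) ℤ.+ x
    lemma₂ = ℤSolver.solve-∀

  carry-⟨+⟩ : ∀ j r l δ → ℤ.∣ δ ∣ ℕ.≤ A →
              Automata._⟨+⟩_ p j r ℤ.+ offset l ℤ.- δ ≡
              Automata._⟨+⟩_ p (j ℤ.+ offset (carry r l δ)) (digit r l δ)
  carry-⟨+⟩ j r l δ δ≤A = ≡.trans (lemma₁ (+ p ℤ.* j) (+ toℕ r) (offset l) δ) (≡.trans
    (≡.cong (λ i → + p ℤ.* j ℤ.+ i) (carry-spec r l δ δ≤A))
    (lemma₂ (+ p) j (offset (carry r l δ)) (+ toℕ (digit r l δ))))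
    where
    lemma₁ : ∀ j r l δ → j ℤ.+ r ℤ.+ l ℤ.- δ ≡ j ℤ.+ (r ℤ.+ l ℤ.- δ)
    lemma₁ = ℤSolver.solve-∀
    lemma₂ : ∀ p j l d → p ℤ.* j ℤ.+ (p ℤ.* l ℤ.+ d) ≡ p ℤ.* (j ℤ.+ l) ℤ.+ d
    lemma₂ = ℤSolver.solve-∀

-- Slices and self-similar expressions

record Classification (V : CommutativeMonoid v ℓ) : Set (v ⊔ ℓ) where
  open CommutativeMonoid V
  field
    classes   : ℕ
    class     : Carrier → Fin classes
    rep       : Fin classes → Carrier
    class-cong : ∀ {x y} → x ≈ y → class x ≡ class y
    rep-class : ∀ x → rep (class x) ≈ x

module Slices (V : CommutativeMonoid v ℓ) (k : ℕ) where
  open Action V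
  open Frobenius V (suc k)
  open Automata p using (_⟨+⟩_)
  open CommutativeSemiring exprs
    using (trans; sym; refl; +-cong; +-congˡ; +-identityˡ; +-identityʳ; +-assoc; *-cong; *-identityˡ; *-identityʳ; distribˡ; distribʳ; zeroˡ; zeroʳ)

  -- The Cartier operator: it extracts the part of a diagram in one residue class modulo p in time
  -- and space.
  slice : Fin p → Fin p → W → W
  slice r s X j i = X (p ℕ.* j ℕ.+ toℕ r) (i ⟨+⟩ s)

  z^n-zero : ∀ n X {j} → j ℕ.< n → ∀ i → ⟦ z ^ n ⟧ X j i V.≈ V.ε
  z^n-zero (suc n) X {zero}  _         i = V.refl
  z^n-zero (suc n) X {suc j} (s≤s j<n) i = z^n-zero n X j<n i

  z^n-shift : ∀ n X j i → ⟦ z ^ n ⟧ X (n ℕ.+ j) i V.≈ X j i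
  z^n-shift zero    X j i = V.refl
  z^n-shift (suc n) X j i = z^n-shift n X j i

  slice-z^p : ∀ r s X → slice r s (⟦ z ^ p ⟧ X) ≋ delay (slice r s X)
  slice-z^p r s X zero    i = z^n-zero p X
    (≡.subst (ℕ._< p) (≡.sym (≡.cong (ℕ._+ toℕ r) (ℕ.*-zeroʳ p))) (Fin.toℕ<n r)) _
  slice-z^p r s X (suc j) i = V.trans
    (V.reflexive (≡.cong (λ n → ⟦ z ^ p ⟧ X n (i ⟨+⟩ s))
      (≡.trans (≡.cong (ℕ._+ toℕ r) (ℕ.*-suc p j)) (ℕ.+-assoc p _ _))))
    (z^n-shift p X (p ℕ.* j ℕ.+ toℕ r) _)

  -- A multiplier in zᵖ and uᵖ does not mix residue classes, so it leaves the slice as the same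
  -- multiplier in z and u.
  slice-ψ : ∀ r s a X → slice r s (⟦ ψ a ⟧ X) ≋ ⟦ a ⟧ (slice r s X)
  slice-ψ r s 𝟘        X = W.refl
  slice-ψ r s 𝟙        X = W.refl
  slice-ψ r s z        X = slice-z^p r s X
  slice-ψ r s (u d)    X j i = V.reflexive (≡.cong (X _) (lemma (+ p) i (+ toℕ s) d))
    where
    lemma : ∀ p i s d → p ℤ.* i ℤ.+ s ℤ.- p ℤ.* d ≡ p ℤ.* (i ℤ.- d) ℤ.+ s
    lemma = ℤSolver.solve-∀
  slice-ψ r s (a ⊕ b)  X = W.∙-cong (slice-ψ r s a X) (slice-ψ r s b X)
  slice-ψ r s (a ⊗ b)  X = W.trans (slice-ψ r s a _) (⟦⟧-cong a (slice-ψ r s b X))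
  slice-ψ r s (star a) X = star-intertwines (z ^ suc k ⊗ ψ a) a (λ X≋Y j i → X≋Y _ _) (λ _ _ → W.refl)
    (λ Y → W.trans (slice-z^p r s (⟦ ψ a ⟧ Y)) (⟦⟧-cong z (slice-ψ r s a Y))) X

  -- With ε at negative times, `delay` becomes an honest translation, and windows may reach below
  -- row 0.
  valueAt : W → ℤ → ℤ → V.Carrier
  valueAt X (+ j)    i = X j i
  valueAt X -[1+ _ ] i = V.ε

  valueAt-cong : ∀ {X Y} → X ≋ Y → ∀ j i → valueAt X j i V.≈ valueAt Y j i
  valueAt-cong X≋Y (+ j)    i = X≋Y j i
  valueAt-cong X≋Y -[1+ _ ] i = V.refl

  valueAt-+ : ∀ X Y j i → valueAt (X +ʷ Y) j i V.≈ valueAt X j i V.∙ valueAt Y j i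
  valueAt-+ X Y (+ j)    i = V.refl
  valueAt-+ X Y -[1+ _ ] i = V.sym (V.identityˡ _)

  valueAt-0 : ∀ j i → valueAt 0ʷ j i V.≈ V.ε
  valueAt-0 (+ j)    i = V.refl
  valueAt-0 -[1+ _ ] i = V.refl

  valueAt-slice : ∀ r s X j i → valueAt X (j ⟨+⟩ r) (i ⟨+⟩ s) V.≈ valueAt (slice r s X) j i
  valueAt-slice r s X (+ j)    i = V.reflexive (≡.cong (λ n → valueAt X n (i ⟨+⟩ s)) (digit-+ p j (toℕ r)))
  valueAt-slice r s X -[1+ j ] i = V.reflexive (≡.cong (λ n → valueAt X n (i ⟨+⟩ s)) (proj₂ (digit-- (suc k) j (Fin.toℕ<n r))))

  valueAt-delay : ∀ X j i → valueAt (delay X) j i V.≈ valueAt X (j ℤ.- + 1) i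
  valueAt-delay X (+ zero)  i = V.refl
  valueAt-delay X (+ suc j) i = V.refl
  valueAt-delay X -[1+ _ ]  i = V.refl

  valueAt-z^n : ∀ n X j i → valueAt (⟦ z ^ n ⟧ X) j i V.≈ valueAt X (j ℤ.- + n) i
  valueAt-z^n zero    X j i = V.reflexive (≡.cong (λ j → valueAt X j i) (≡.sym (ℤ.+-identityʳ j)))
  valueAt-z^n (suc n) X j i = V.trans (valueAt-delay (⟦ z ^ n ⟧ X) j i) (V.trans (valueAt-z^n n X (j ℤ.- + 1) i)
    (V.reflexive (≡.cong (λ j → valueAt X j i) (lemma j (+ n)))))
    where
    lemma : ∀ j n → j ℤ.- + 1 ℤ.- n ≡ j ℤ.- (+ 1 ℤ.+ n)
    lemma = ℤSolver.solve-∀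

  valueAt-u : ∀ d X j i → valueAt (⟦ u d ⟧ X) j i V.≈ valueAt X j (i ℤ.- d)
  valueAt-u d X (+ _)    i = V.refl
  valueAt-u d X -[1+ _ ] i = V.refl

  Shifts : Set
  Shifts = List (ℕ ∧ ℤ)

  laurent : Shifts → Expr
  laurent []             = 𝟘
  laurent ((n , d) ∷ ss) = z ^ n ⊗ u d ⊕ laurent ss

  -- The action of a Laurent polynomial with the source of the values left open: it is applied to
  -- diagrams as well as to states of an automaton.
  gather : Shifts → (ℤ → ℤ → V.Carrier) → V.Carrier
  gather []             f = V.ε
  gather ((n , d) ∷ ss) f = f (+ n) d V.∙ gather ss f

  valueAt-laurent : ∀ ss X j i →
    valueAt (⟦ laurent ss ⟧ X) j i V.≈ gather ss (λ n d → valueAt X (j ℤ.- n) (i ℤ.- d))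
  valueAt-laurent []             X j i = valueAt-0 j i
  valueAt-laurent ((n , d) ∷ ss) X j i = V.trans (valueAt-+ _ _ j i) (V.∙-cong
    (V.trans (valueAt-z^n n (⟦ u d ⟧ X) j i) (valueAt-u d X (j ℤ.- + n) i)) (valueAt-laurent ss X j i))

  Expansion : Expr → Set _
  Expansion a = ∃ λ ss → a ≈ᵉ laurent ss

  expand-⊕ : ∀ ss tt → laurent ss ⊕ laurent tt ≈ᵉ laurent (ss ++ tt)
  expand-⊕ []       tt = +-identityˡ _
  expand-⊕ (s ∷ ss) tt = trans (+-assoc _ _ _) (+-congˡ (expand-⊕ ss tt))

  expand-shift : ∀ n d tt → z ^ n ⊗ u d ⊗ laurent tt ≈ᵉ laurent (map (λ (n′ , d′) → n ℕ.+ n′ , d ℤ.+ d′) tt)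
  expand-shift n d []              = zeroʳ _
  expand-shift n d ((n′ , d′) ∷ tt) = trans (distribˡ _ _ _) (+-cong
    (trans (solve 4 (λ a b c d → a :* b :* (c :* d) := a :* c :* (b :* d))
         refl (z ^ n) (u d) (z ^ n′) (u d′))
      (*-cong (sym (^-homo-* z n n′)) (u-+ d d′)))
    (expand-shift n d tt))

  expand-⊗ : ∀ ss tt → Expansion (laurent ss ⊗ laurent tt)
  expand-⊗ []             tt = [] , zeroˡ _
  expand-⊗ ((n , d) ∷ ss) tt with expand-⊗ ss tt
  ... | rr , eq = _ , trans (distribʳ _ _ _) (trans (+-cong (expand-shift n d tt) eq) (expand-⊕ _ rr))

  expand : ∀ {a} → StarFree a → Expansion a
  expand 𝟘     = [] , refl
  expand 𝟙     = (0 , + 0) ∷ [] , sym (trans (+-identityʳ _) (trans (*-identityˡ _) u-0))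
  expand z     = (1 , + 0) ∷ [] , sym (trans (+-identityʳ _) (trans (*-cong (*-identityʳ z) u-0) (*-identityʳ z)))
  expand (u d) = (0 , d) ∷ [] , sym (trans (+-identityʳ _) (*-identityˡ _))
  expand (A ⊕ B) with expand A | expand B
  ... | ss , eq | tt , eq′ = ss ++ tt , trans (+-cong eq eq′) (expand-⊕ ss tt)
  expand (A ⊗ B) with expand A | expand B
  ... | ss , eq | tt , eq′ with expand-⊗ ss tt
  ...   | rr , eq″ = rr , trans (*-cong eq eq′) eq″

  Bounded : ℕ → Shifts → Set
  Bounded A = All (λ (n , d) → n ℕ.≤ A ∧ ℤ.∣ d ∣ ℕ.≤ A)

  bound : Shifts → ℕ
  bound = foldr (λ (n , d) A → n ℕ.+ ℤ.∣ d ∣ ℕ.+ A) 0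

  bounded : ∀ ss {A} → bound ss ℕ.≤ A → Bounded A ss
  bounded []             _   = []
  bounded ((n , d) ∷ ss) b≤A =
    (ℕ.≤-trans (ℕ.≤-trans (ℕ.m≤m+n n _) (ℕ.m≤m+n _ _)) b≤A ,
     ℕ.≤-trans (ℕ.≤-trans (ℕ.m≤n+m _ n) (ℕ.m≤m+n _ _)) b≤A) ∷
    bounded ss (ℕ.≤-trans (ℕ.m≤n+m _ _) b≤A)

  gather-cong : ∀ {A} ss → Bounded A ss → ∀ {f g : ℤ → ℤ → V.Carrier} →
    (∀ n d → ℤ.∣ n ∣ ℕ.≤ A → ℤ.∣ d ∣ ℕ.≤ A → f n d V.≈ g n d) → gather ss f V.≈ gather ss g
  gather-cong []             []               f≈g = V.refl
  gather-cong ((n , d) ∷ ss) ((n≤ , d≤) ∷ bs) f≈g = V.∙-cong (f≈g (+ n) d n≤ d≤) (gather-cong ss bs f≈g)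

  gather-cong′ : ∀ ss {f g : ℤ → ℤ → V.Carrier} → (∀ n d → f n d V.≈ g n d) → gather ss f V.≈ gather ss g
  gather-cong′ []             f≈g = V.refl
  gather-cong′ ((n , d) ∷ ss) f≈g = V.∙-cong (f≈g (+ n) d) (gather-cong′ ss f≈g)

-- Automaticity of rational series applied to initial rows

module Solutions (V : CommutativeMonoid v ℓ) (k : ℕ) (classification : Classification V)
                 (one : CommutativeMonoid.Carrier V) {m : ℕ} (e : ℤ → Fin m)
                 (g : Fin (2 ℕ.+ k) → Fin m → Fin m)
                 (e-step : ∀ s i → e (Automata._⟨+⟩_ (2 ℕ.+ k) i s) ≡ g s (e i)) where
  open Action V
  open Frobenius V (suc k)
  open Slices V k
  open Automata p
  open Classification classification
  open CommutativeSemiring exprs using (trans; sym; *-congʳ)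

  value : Fin 2 → V.Carrier
  value zero    = V.ε
  value (suc _) = one

  -- Sets of states are used, not single states, because the preimage of a state under a digit can
  -- contain several states.
  initial : (Fin m → Fin 2) → W
  initial φ zero    i = value (φ (e i))
  initial φ (suc j) i = V.ε

  initial-cong : ∀ {φ χ} → φ ≗ χ → initial φ ≋ initial χ
  initial-cong φ≗χ zero    i = V.reflexive (≡.cong value (φ≗χ _))
  initial-cong φ≗χ (suc j) i = V.refl

  -- Slicing an initial row only changes φ, so these finitely many rows form a
  -- closed family.
  step : Fin p → Fin p → (Fin m → Fin 2) → Fin m → Fin 2
  step zero    s φ = φ ∘ g s
  step (suc _) s φ = λ _ → zero

  slice-initial : ∀ r s φ → slice r s (initial φ) ≋ initial (step r s φ)
  slice-initial zero s φ zero i = V.trans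
    (V.reflexive (≡.cong (λ n → initial φ n (i ⟨+⟩ s)) (≡.trans (ℕ.+-identityʳ _) (ℕ.*-zeroʳ p))))
    (V.reflexive (≡.cong (value ∘ φ) (e-step s i)))
  slice-initial zero s φ (suc j) i = V.refl
  slice-initial (suc r) s φ j i = V.trans
    (V.reflexive (≡.cong (λ n → initial φ n (i ⟨+⟩ s)) (ℕ.+-suc (p ℕ.* j) (toℕ r)))) (ε-initial j i)
    where
    ε-initial : ∀ j i → V.ε V.≈ initial (λ _ → zero) j i
    ε-initial zero    i = V.refl
    ε-initial (suc _) i = V.refl

  AutomaticDiagram : W → Set
  AutomaticDiagram X = Automatic (λ j i → class (valueAt X j i))

  automatic-resp : ∀ {X Y} → X ≋ Y → AutomaticDiagram Y → AutomaticDiagram X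
  automatic-resp X≋Y Ya = automatic-map (λ c → c) Ya (λ j i → class-cong (valueAt-cong X≋Y j i))

  automatic-+ : ∀ {X Y} → AutomaticDiagram X → AutomaticDiagram Y → AutomaticDiagram (X +ʷ Y)
  automatic-+ {X} {Y} Xa Ya = automatic-map (λ (c , d) → class (rep c V.∙ rep d)) (automatic-zip Xa Ya)
    λ j i → class-cong (V.trans (valueAt-+ X Y j i)
      (V.sym (V.∙-cong (rep-class (valueAt X j i)) (rep-class (valueAt Y j i)))))

  automatic-0 : AutomaticDiagram 0ʷ
  automatic-0 = automatic-map (λ c → c) (automatic-const (class V.ε)) (λ j i → class-cong (valueAt-0 j i))

  module _ {q d : Expr} (Q : StarFree q) (D : SelfSimilar d) (φ₀ : Fin m → Fin 2) where
    private
      ss tt : Shifts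
      ss = proj₁ (expand Q)
      tt = proj₁ (expand (proj₁ (proj₂ D)))
      A : ℕ
      -- The window has to hold the shifts of q, for the output, and those of the recursion for d,
      -- for the transitions.
      A = bound ss ℕ.+ bound tt
      open Window k A using (L; offset; carry; digit; locate; offset-locate; carry-⟨+⟩)

      -- A state of the automaton stores the values of d on all 2^m initial rows, at all offsets in
      -- time and space.
      Index : Set
      Index = Fin (2 ℕ.^ m) ∧ Fin L ∧ Fin L

      diagram : Fin (2 ℕ.^ m) → W
      diagram c = ⟦ d ⟧ (initial (finToFun c))

      f : Index → ℤ → ℤ → Fin classes
      f (c , l , l′) j i = class (valueAt (diagram c) (j ℤ.+ offset l) (i ℤ.+ offset l′))

      -- Shift, digit and offset combine into a new offset and a residue; the residue selects the
      -- slice to be taken of the initial row.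
      next : Fin p → Fin p → Index → ℤ → ℤ → Index
      next r s (c , l , l′) n d =
        funToFin (step (digit r l n) (digit s l′ d) (finToFun c)) , carry r l n , carry s l′ d

      G : Fin p → Fin p → (Index → Fin classes) → Index → Fin classes
      G r s φ ι = class (gather tt (λ n d → rep (φ (next r s ι n d))))

      d≈ : d ≈ᵉ laurent tt ⊗ ψ d
      d≈ = trans (proj₂ (proj₂ D)) (*-congʳ (proj₂ (expand (proj₁ (proj₂ D)))))

      -- In d = q ψ(d) the factor q becomes a sum of shifts. At each shifted position the residue
      -- picks a slice, which turns ψ(d) back into d applied to another initial row.
      f-step : ∀ r s j i ι → f ι (j ⟨+⟩ r) (i ⟨+⟩ s) ≡ G r s (λ κ → f κ j i) ι
      f-step r s j i ι@(c , l , l′) = class-cong (V.trans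
        (valueAt-cong (act d≈ X) J I) (V.trans
        (valueAt-laurent tt (⟦ ψ d ⟧ X) J I)
        (gather-cong tt (bounded tt (ℕ.m≤n+m (bound tt) (bound ss))) cell)))
        where
        X = initial (finToFun c)
        J = j ⟨+⟩ r ℤ.+ offset l
        I = i ⟨+⟩ s ℤ.+ offset l′
        cell : ∀ n δ → ℤ.∣ n ∣ ℕ.≤ A → ℤ.∣ δ ∣ ℕ.≤ A →
          valueAt (⟦ ψ d ⟧ X) (j ⟨+⟩ r ℤ.+ offset l ℤ.- n) (i ⟨+⟩ s ℤ.+ offset l′ ℤ.- δ) V.≈
          rep (f (next r s ι n δ) j i)
        cell n δ n≤A δ≤A = V.trans
          (V.reflexive (≡.cong₂ (valueAt (⟦ ψ d ⟧ X)) (carry-⟨+⟩ j r l n n≤A) (carry-⟨+⟩ i s l′ δ δ≤A))) (V.trans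
          (valueAt-slice r′ s′ (⟦ ψ d ⟧ X) j′ i′) (V.trans
          (valueAt-cong (W.trans (slice-ψ r′ s′ d X) (⟦⟧-cong d (W.trans
            (slice-initial r′ s′ (finToFun c))
            (initial-cong (≡.sym ∘ Fin.finToFun-funToFin (step r′ s′ (finToFun c))))))) j′ i′)
          (V.sym (rep-class _))))
          where
          r′ = digit r l n
          s′ = digit s l′ δ
          j′ = j ℤ.+ offset (carry r l n)
          i′ = i ℤ.+ offset (carry s l′ δ)

      c₀ : Fin (2 ℕ.^ m)
      c₀ = funToFin φ₀

      out : (Index → Fin classes) → Fin classes
      out φ = class (gather ss (λ n d → rep (φ (c₀ , locate n , locate d))))

      out-correct : ∀ j i → class (valueAt (⟦ q ⊗ d ⟧ (initial φ₀)) j i) ≡ out (λ κ → f κ j i)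
      out-correct j i = class-cong (V.trans
        (valueAt-cong (W.trans (act (proj₂ (expand Q)) _) (⟦⟧-cong (laurent ss) (⟦⟧-cong d
          (initial-cong (≡.sym ∘ Fin.finToFun-funToFin φ₀))))) j i) (V.trans
        (valueAt-laurent ss (diagram c₀) j i)
        (gather-cong ss (bounded ss (ℕ.m≤m+n (bound ss) (bound tt))) λ n d n≤A d≤A →
          V.sym (V.trans (rep-class _) (V.reflexive
            (≡.cong₂ (λ x y → valueAt (diagram c₀) (j ℤ.+ x) (i ℤ.+ y)) (offset-locate n n≤A) (offset-locate d d≤A)))))))

      code : Index → Fin (2 ℕ.^ m ℕ.* (L ℕ.* L))
      code (c , l , l′) = combine c (combine l l′)

      index : Fin (2 ℕ.^ m ℕ.* (L ℕ.* L)) → Index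
      index x = let c , y = remQuot (L ℕ.* L) x in c , remQuot L y

      inverse : ∀ ι → index (code ι) ≡ ι
      inverse (c , l , l′) = ≡.trans
        (≡.cong (λ (c , y) → c , remQuot L y) (Fin.remQuot-combine c (combine l l′)))
        (≡.cong (c ,_) (Fin.remQuot-combine l l′))

    automatic-selfSimilar : AutomaticDiagram (⟦ q ⊗ d ⟧ (initial φ₀))
    automatic-selfSimilar = automatic-map (λ c → c)
      (automatic-family code index inverse f G
        (λ r s φ≗χ ι → class-cong (gather-cong′ tt (λ n d → V.reflexive (≡.cong rep (φ≗χ _)))))
        f-step out
        (λ φ≗χ → class-cong (gather-cong′ ss (λ n d → V.reflexive (≡.cong rep (φ≗χ _))))))
      out-correct

  automatic-decomposed : ∀ {b} → Decomposed b → ∀ φ → AutomaticDiagram (⟦ b ⟧ (initial φ))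
  automatic-decomposed 𝟘           φ = automatic-0
  automatic-decomposed (add Q D B) φ = automatic-+ (automatic-selfSimilar Q D φ) (automatic-decomposed B φ)

  automatic-solution : (∀ a → Decomposable a) → ∀ {n} (A : Fin n → Fin n → Expr) (φ : Fin n → Fin m → Fin 2)
    (X : Fin n → W) →
    (∀ y → X y ≋ initial (φ y) +ʷ Elimination.combination V (λ x → z ⊗ A y x) X) →
    ∀ y → AutomaticDiagram (X y)
  automatic-solution decompose {n} A φ X eq y =
    automatic-resp (proj₂ spanned) (automatic-combination (proj₁ spanned) φ)
    where
    open Elimination V
    spanned = eliminate (initial ∘ φ) A (initial ∘ φ) X (spanned-generator (initial ∘ φ)) eq y
    automatic-combination : ∀ {n} (G : Fin n → Expr) (φ : Fin n → Fin m → Fin 2) →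
      AutomaticDiagram (combination G (initial ∘ φ))
    automatic-combination {zero}  G φ = automatic-0
    automatic-combination {suc n} G φ with decompose (G zero)
    ... | b , B , eq = automatic-+ (automatic-resp (act eq _) (automatic-decomposed B (φ zero)))
      (automatic-combination (G ∘ suc) (φ ∘ suc))

-- Periods

least : {P : Pred ℕ a} → Decidable P → ∀ n → P n → ∃ λ m → P m ∧ (∀ k → P k → m ℕ.≤ k)
least P? n Pn with P? 0
least P? n       Pn | yes P0 = 0 , P0 , λ _ _ → z≤n
least P? zero    Pn | no ¬P0 = contradiction Pn ¬P0
least P? (suc n) Pn | no ¬P0 with least (P? ∘ suc) n Pn
... | m , Pm , minimal = suc m , Pm , λ where
  zero    P0 → contradiction P0 ¬P0
  (suc k) Pk → s≤s (minimal k Pk)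

only-prime-divisor⇒power : ∀ p n .{{_ : ℕ.NonZero n}} → (∀ {q} → Prime q → q ∣ n → p ≡ q) → ∃ λ e → n ≡ p ℕ.^ e
only-prime-divisor⇒power p n only = power (factors f) (factorsPrime f) n (isFactorisation f) only
  where
  open PrimeFactorisation
  f = factorise n
  power : ∀ ps → All Prime ps → ∀ n → n ≡ product ps → (∀ {q} → Prime q → q ∣ n → p ≡ q) → ∃ λ e → n ≡ p ℕ.^ e
  power []       []         n eq     _    = 0 , eq
  power (q ∷ ps) (pr ∷ prs) n ≡.refl only with power ps prs _ ≡.refl (λ r-prime r∣ → only r-prime (∣-trans r∣ (n∣m*n q)))
  ... | e , eq with only pr (m∣m*n (product ps))
  ...   | ≡.refl = suc e , ≡.cong (q ℕ.*_) eq

module Periodicity (M : CommutativeMonoid v ℓ) where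
  open CommutativeMonoid M
  open import Algebra.Properties.Monoid.Mult monoid using (×-homo-+; ×-congˡ) renaming (_×_ to _·_)
  open import Relation.Binary.Reasoning.Setoid setoid

  module _ {x t q} (return : (t ℕ.+ q) · x ≈ t · x) where

    return-≥ : ∀ {s} → t ℕ.≤ s → (s ℕ.+ q) · x ≈ s · x
    return-≥ {s} t≤s = begin
      (s ℕ.+ q) · x               ≈⟨ ×-congˡ (≡.trans (≡.cong (ℕ._+ q) (≡.sym (ℕ.m∸n+n≡m t≤s))) (ℕ.+-assoc (s ℕ.∸ t) t q)) ⟩
      (s ℕ.∸ t ℕ.+ (t ℕ.+ q)) · x ≈⟨ ×-homo-+ x (s ℕ.∸ t) _ ⟩
      (s ℕ.∸ t) · x ∙ (t ℕ.+ q) · x ≈⟨ ∙-congˡ return ⟩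
      (s ℕ.∸ t) · x ∙ t · x       ≈⟨ ×-homo-+ x (s ℕ.∸ t) t ⟨
      (s ℕ.∸ t ℕ.+ t) · x         ≈⟨ ×-congˡ (ℕ.m∸n+n≡m t≤s) ⟩
      s · x                       ∎

    return-* : ∀ n {s} → t ℕ.≤ s → (s ℕ.+ n ℕ.* q) · x ≈ s · x
    return-* zero    {s} t≤s = ×-congˡ (ℕ.+-identityʳ s)
    return-* (suc n) {s} t≤s = begin
      (s ℕ.+ (q ℕ.+ n ℕ.* q)) · x ≈⟨ ×-congˡ (≡.sym (ℕ.+-assoc s q _)) ⟩
      (s ℕ.+ q ℕ.+ n ℕ.* q) · x   ≈⟨ return-* n (ℕ.≤-trans t≤s (ℕ.m≤m+n s q)) ⟩
      (s ℕ.+ q) · x               ≈⟨ return-≥ t≤s ⟩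
      s · x                       ∎

    -- As q is positive, t q is at least t; so the new multiple lies beyond the preperiod, is
    -- congruent to n modulo q, and depends only on the remainder of n.
    canonical : .{{_ : ℕ.NonZero q}} → ∀ n → t ℕ.≤ n → n · x ≈ (n % q ℕ.+ t ℕ.* q) · x
    canonical n t≤n = begin
      n · x                             ≈⟨ return-* t t≤n ⟨
      (n ℕ.+ t ℕ.* q) · x               ≈⟨ ×-congˡ (≡.trans (≡.cong (ℕ._+ t ℕ.* q) (m≡m%n+[m/n]*n n q))
                                             (lemma (n % q) (n / q ℕ.* q) (t ℕ.* q))) ⟩
      (n % q ℕ.+ t ℕ.* q ℕ.+ n / q ℕ.* q) · x
                                        ≈⟨ return-* (n / q) (ℕ.≤-trans (ℕ.m≤m*n t q) (ℕ.m≤n+m _ (n % q))) ⟩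
      (n % q ℕ.+ t ℕ.* q) · x           ∎
      where
      lemma : ∀ a b c → a ℕ.+ b ℕ.+ c ≡ a ℕ.+ c ℕ.+ b
      lemma = ℕSolver.solve-∀

  -- Adding t′ multiples of q moves past t′, where q′ is a return; the same multiples are then taken
  -- away again. Thus preperiod and period can be minimised separately.
  return-transfer : ∀ x t q t′ q′ → IsReturn M x t q → IsReturn M x t′ q′ → IsReturn M x t q′
  return-transfer x t q t′ q′ (0<q , return) (0<q′ , return′) = 0<q′ , (begin
    (t ℕ.+ q′) · x              ≈⟨ return-* {x} {t} {q} return t′ (ℕ.m≤m+n t q′) ⟨
    (t ℕ.+ q′ ℕ.+ t′ ℕ.* q) · x ≈⟨ ×-congˡ (lemma t q′ (t′ ℕ.* q)) ⟩
    (t ℕ.+ t′ ℕ.* q ℕ.+ q′) · x ≈⟨ return-≥ {x} {t′} {q′} return′ (ℕ.≤-trans (ℕ.m≤m*n t′ q {{ℕ.>-nonZero 0<q}}) (ℕ.m≤n+m _ t)) ⟩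
    (t ℕ.+ t′ ℕ.* q) · x        ≈⟨ return-* {x} {t} {q} return t′ ℕ.≤-refl ⟩
    t · x                       ∎)
    where
    lemma : ∀ a b c → a ℕ.+ b ℕ.+ c ≡ a ℕ.+ c ℕ.+ b
    lemma = ℕSolver.solve-∀

  module _ (finite : Finite setoid) where
    open Inverse (proj₂ finite) using (to; from; to-cong; strictlyInverseʳ)

    infix 4 _≟_
    _≟_ : ∀ x y → Dec (x ≈ y)
    x ≟ y = map′ (λ eq → trans (sym (strictlyInverseʳ x)) (trans (reflexive (≡.cong from eq)) (strictlyInverseʳ y)))
      to-cong (to x Fin.≟ to y)

    hasReturn : ∀ x → ∃₂ (IsReturn M x)
    hasReturn x with Fin.pigeonhole (ℕ.n<1+n (proj₁ finite)) (λ i → to (toℕ i · x))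
    ... | i , j , i<j , eq = toℕ i , toℕ j ℕ.∸ toℕ i , ℕ.m<n⇒0<n∸m i<j ,
      trans (×-congˡ (ℕ.m+[n∸m]≡n (ℕ.<⇒≤ i<j)))
        (trans (sym (strictlyInverseʳ _)) (trans (reflexive (≡.cong from (≡.sym eq))) (strictlyInverseʳ _)))

    isReturn? : ∀ x t q → Dec (IsReturn M x t q)
    isReturn? x t q = (0 ℕ.<? q) ×-dec ((t ℕ.+ q) · x ≟ t · x)

    -- The preperiod is minimised for one known period, then the period for that preperiod.
    -- `return-transfer` makes both minima hold against all pairs.
    hasPeriod : ∀ x → ∃ (IsPeriod M x)
    hasPeriod x with hasReturn x
    ... | t₀ , q₀ , r₀ with least (λ t → isReturn? x t q₀) t₀ r₀
    ...   | t , r , t-min with least (λ q → isReturn? x t q) q₀ r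
    ...     | q , r′ , q-min = q , t , r′ , λ t′ q′ return →
      t-min t′ (return-transfer x t′ q′ t₀ q₀ return r₀) , q-min q′ (return-transfer x t q₀ t′ q′ r return)

    module _ (p : ℕ) (π⊆p : π M ⊆ ｛ p ｝) where

      hasReturn-power : ∀ x → ∃₂ λ t e → (t ℕ.+ p ℕ.^ e) · x ≈ t · x
      hasReturn-power x = power (hasPeriod x)
        where
        power : ∃ (IsPeriod M x) → ∃₂ λ t e → (t ℕ.+ p ℕ.^ e) · x ≈ t · x
        power (q , isPeriod@(t , (0<q , return) , _)) =
          t , proj₁ q-power , ≡.subst (λ q → (t ℕ.+ q) · x ≈ t · x) (proj₂ q-power) return
          where
          q-power : ∃ λ e → q ≡ p ℕ.^ e
          q-power = only-prime-divisor⇒power p q {{ℕ.>-nonZero 0<q}}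
            (λ r-prime r∣q → π⊆p (r-prime , x , q , isPeriod , r∣q))

      Uniform : ∀ {n} → (Fin n → Carrier) → Set _
      Uniform xs = ∃₂ λ t e → ∀ i → (t ℕ.+ p ℕ.^ e) · xs i ≈ t · xs i

      weaken : ∀ {x t e} → (t ℕ.+ p ℕ.^ e) · x ≈ t · x → ∀ e′ {s} → t ℕ.≤ s →
               (s ℕ.+ p ℕ.^ (e′ ℕ.+ e)) · x ≈ s · x
      weaken {x} {t} {e} return e′ {s} t≤s =
        trans (×-congˡ (≡.cong (s ℕ.+_) (ℕ.^-distribˡ-+-* p e′ e))) (return-* {x} {t} {p ℕ.^ e} return (p ℕ.^ e′) t≤s)

      uniform : ∀ {n} (xs : Fin n → Carrier) → Uniform xs
      uniform {zero}  xs = 0 , 0 , λ ()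
      uniform {suc n} xs = extend-uniform (hasReturn-power (xs zero)) (uniform (xs ∘ suc))
        where
        extend-uniform : (∃₂ λ t e → (t ℕ.+ p ℕ.^ e) · xs zero ≈ t · xs zero) → Uniform (xs ∘ suc) → Uniform xs
        extend-uniform (t , e , return) (t′ , e′ , returns) = t ℕ.+ t′ , e ℕ.+ e′ , λ where
          zero    → ≡.subst (λ e → (t ℕ.+ t′ ℕ.+ p ℕ.^ e) · xs zero ≈ (t ℕ.+ t′) · xs zero) (ℕ.+-comm e′ e)
            (weaken {xs zero} {t} {e} return e′ (ℕ.m≤m+n t t′))
          (suc i) → weaken {xs (suc i)} {t′} {e′} (returns i) e (ℕ.m≤n+m t′ t)

-- Quotients of the additive monoid of natural numbers

module Reduction (f : ℕ → ℕ) (f-idem : ∀ n → f (f n) ≡ f n) (f-+ : ∀ m n → f (f m ℕ.+ f n) ≡ f (m ℕ.+ n)) where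

  -- The carrier stays ℕ and only equality changes, so one and the same diagram of counts can be
  -- read in both quotients.
  monoid : CommutativeMonoid 0ℓ 0ℓ
  monoid = record
    { Carrier = ℕ
    ; _≈_ = λ m n → f m ≡ f n
    ; _∙_ = ℕ._+_
    ; ε = 0
    ; isCommutativeMonoid = record
      { isMonoid = record
        { isSemigroup = record
          { isMagma = record
            { isEquivalence = record { refl = ≡.refl ; sym = ≡.sym ; trans = ≡.trans }
            ; ∙-cong = λ {m} {n} {o} {q} eq eq′ →
                ≡.trans (≡.sym (f-+ m o)) (≡.trans (≡.cong₂ (λ x y → f (x ℕ.+ y)) eq eq′) (f-+ n q))
            }
          ; assoc = λ m n o → ≡.cong f (ℕ.+-assoc m n o)
          }
        ; identity = (λ _ → ≡.refl) , λ n → ≡.cong f (ℕ.+-identityʳ n)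
        }
      ; comm = λ m n → ≡.cong f (ℕ.+-comm m n)
      }
    }

  open import Algebra.Properties.Monoid.Mult (CommutativeMonoid.monoid monoid) public
    using () renaming (_×_ to _·_)

  ·≡* : ∀ m n → m · n ≡ m ℕ.* n
  ·≡* zero    n = ≡.refl
  ·≡* (suc m) n = ≡.cong (n ℕ.+_) (·≡* m n)

-- Lifting the cellular automaton to exponents

module LinearAutomaton (M : CommutativeMonoid v ℓ)
  (F : (ℤ → CommutativeMonoid.Carrier M) → (ℤ → CommutativeMonoid.Carrier M))
  (automaton : IsCellularAutomaton (CommutativeMonoid.setoid M) F) (endomorphism : IsEndomorphism M F) where
  open CommutativeMonoid M
  open IsCellularAutomaton automaton
  open import Algebra.Properties.CommutativeSemigroup commutativeSemigroup using (interchange)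
  open import Algebra.Properties.CommutativeMonoid.Mult M
    using (×-homo-+; ×-congˡ; ×-congʳ) renaming (_×_ to _·_)
  open import Algebra.Properties.CommutativeMonoid.Sum M
    using (sum; sum-cong-≋; ∑-distrib-+; ∑-comm; sum-replicate-zero)
  open import Relation.Binary.Reasoning.Setoid setoid
  private module F = MonoidMorphisms.IsMonoidHomomorphism endomorphism

  sumᵛ : ∀ {n} → Vec ℤ n → (ℤ → Carrier) → Carrier
  sumᵛ []       f = ε
  sumᵛ (d ∷ ds) f = f d ∙ sumᵛ ds f

  sumᵛ-cong : ∀ {n} (ds : Vec ℤ n) {f g} → (∀ d → f d ≈ g d) → sumᵛ ds f ≈ sumᵛ ds g
  sumᵛ-cong []       f≈g = refl
  sumᵛ-cong (d ∷ ds) f≈g = ∙-cong (f≈g d) (sumᵛ-cong ds f≈g)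

  single : ℤ → Carrier → ℤ → Carrier
  single d x i = if does (d ℤ.≟ i) then x else ε

  single-≡ : ∀ d x → single d x d ≈ x
  single-≡ d x rewrite dec-true (d ℤ.≟ d) ≡.refl = refl

  single-≢ : ∀ {d i} x → d ≢ i → single d x i ≈ ε
  single-≢ {d} {i} x d≢i rewrite dec-false (d ℤ.≟ i) d≢i = refl

  single-∙ : ∀ d x y i → single d (x ∙ y) i ≈ single d x i ∙ single d y i
  single-∙ d x y i with does (d ℤ.≟ i)
  ... | true  = refl
  ... | false = sym (identityˡ ε)

  single-ε : ∀ d i → single d ε i ≈ ε
  single-ε d i with does (d ℤ.≟ i)
  ... | true  = refl
  ... | false = refl

  component : ℤ → Carrier → Carrier
  component d x = F (single d x) 0ℤ

  component-∙ : ∀ d x y → component d (x ∙ y) ≈ component d x ∙ component d y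
  component-∙ d x y = trans (F.⟦⟧-cong (single-∙ d x y) 0ℤ) (F.homo (single d x) (single d y) 0ℤ)

  component-ε : ∀ d → component d ε ≈ ε
  component-ε d = trans (F.⟦⟧-cong (single-ε d) 0ℤ) (F.ε-homo 0ℤ)

  component-· : ∀ d n x → component d (n · x) ≈ n · component d x
  component-· d zero    x = component-ε d
  component-· d (suc n) x = trans (component-∙ d x (n · x)) (∙-congˡ (component-· d n x))

  component-sum : ∀ d {n} (f : Fin n → Carrier) → component d (sum f) ≈ sum (component d ∘ f)
  component-sum d {zero}  f = component-ε d
  component-sum d {suc n} f = trans (component-∙ d (f zero) _) (∙-congˡ (component-sum d (f ∘ suc)))

  restrict : ∀ {n} → Vec ℤ n → (ℤ → Carrier) → ℤ → Carrier
  restrict ds r i = sumᵛ ds (λ d → single d (r d) i)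

  restrict-∉ : ∀ {n i} {ds : Vec ℤ n} r → VecAll.All (i ≢_) ds → restrict ds r i ≈ ε
  restrict-∉ r []           = refl
  restrict-∉ r (i≢d ∷ i∉ds) = trans (∙-cong (single-≢ (r _) (i≢d ∘ ≡.sym)) (restrict-∉ r i∉ds)) (identityˡ ε)

  -- Uniqueness of the neighbourhood ensures that no entry is multiplied in twice.
  restrict-∈ : ∀ {n} {ds : Vec ℤ n} r → Unique ds → VecAll.All (λ d → r d ≈ restrict ds r d) ds
  restrict-∈ r []             = []
  restrict-∈ {ds = d ∷ _} r (d∉ds ∷ !ds) =
    sym (trans (∙-cong (single-≡ d (r d)) (restrict-∉ r d∉ds)) (identityʳ _)) ∷
    VecAll.map (λ (d≢d′ , eq) → trans eq (sym (trans (∙-congʳ (single-≢ (r d) d≢d′)) (identityˡ _))))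
      (VecAll.zip (d∉ds , restrict-∈ r !ds))

  F-restrict : ∀ {n} (ds : Vec ℤ n) r → F (restrict ds r) 0ℤ ≈ sumᵛ ds (λ d → component d (r d))
  F-restrict []       r = F.ε-homo 0ℤ
  F-restrict (d ∷ ds) r = trans (F.homo (single d (r d)) (restrict ds r) 0ℤ) (∙-congˡ (F-restrict ds r))

  -- A homomorphism respects finite products, but a configuration is an infinite product of its
  -- entries. Locality allows it to be replaced by its restriction to the neighbourhood, which is a
  -- finite one.
  F-local : ∀ r n → F r n ≈ sumᵛ neighbourhood (λ d → component d (r (n ℤ.+ d)))
  F-local r n = trans (local r n) (trans (rule-cong (pointwise (restrict-∈ r′ unique))) (trans
    (sym (local (restrict neighbourhood r′) 0ℤ)) (F-restrict neighbourhood r′)))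
    where
    r′ : ℤ → Carrier
    r′ d = r (n ℤ.+ d)
    pointwise : ∀ {n} {ds : Vec ℤ n} → VecAll.All (λ d → r′ d ≈ restrict neighbourhood r′ d) ds →
      VecPointwise.Pointwise _≈_ (Vec.map r′ ds) (Vec.map (λ d → restrict neighbourhood r′ (0ℤ ℤ.+ d)) ds)
    pointwise []                    = VecPointwise.[]
    pointwise {ds = d ∷ _} (eq ∷ eqs) = trans eq
      (reflexive (≡.cong (restrict neighbourhood r′) (≡.sym (ℤ.+-identityˡ d)))) VecPointwise.∷ pointwise eqs

  sum-· : ∀ {n} (f : Fin n → ℕ) x → Vector.foldr ℕ._+_ 0 f · x ≈ sum (λ i → f i · x)
  sum-· {zero}  f x = refl
  sum-· {suc n} f x = trans (×-homo-+ x (f zero) _) (∙-congˡ (sum-· (f ∘ suc) x))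

  sum-indicator : ∀ {n} (q : Fin n) k (g : Fin n → Carrier) →
    sum (λ y → (if does (q Fin.≟ y) then k else 0) · g y) ≈ k · g q
  sum-indicator {suc n} zero k g = trans (∙-congˡ (sum-replicate-zero n)) (identityʳ _)
  sum-indicator (suc q) k g = trans (identityˡ _) (sum-indicator q k (g ∘ suc))

  module Lifting (finite : Finite setoid) {m : ℕ} (e : ℤ → Fin m) (label : Fin m → Fin (proj₁ finite)) where
    open Inverse (proj₂ finite) using (to; from; to-cong; strictlyInverseʳ)
    N = proj₁ finite

    target : ℤ → Fin N → Fin N
    target d x = to (component d (from x))

    -- i − (− d) is i + d in the form in which u (− d) acts on rows.
    contribution : ∀ {n} → Vec ℤ n → Fin N → Fin N → (ℤ → ℕ) → ℤ → ℕ
    contribution []       y x c i = 0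
    contribution (d ∷ ds) y x c i =
      (if does (target d x Fin.≟ y) then c (i ℤ.- ℤ.- d) else 0) ℕ.+ contribution ds y x c i

    -- counts j y i is the exponent of y in the product expanding Fʲ(c)ᵢ.
    counts : ℕ → Fin N → ℤ → ℕ
    counts zero    y i = if does (label (e i) Fin.≟ y) then 1 else 0
    counts (suc j) y i = Vector.foldr ℕ._+_ 0 (λ x → contribution neighbourhood y x (counts j x) i)

    evaluate : (Fin N → ℕ) → Carrier
    evaluate k = sum (λ y → k y · from y)

    evaluate-contribution : ∀ {n} (ds : Vec ℤ n) x c i →
      sum (λ y → contribution ds y x c i · from y) ≈ sumᵛ ds (λ d → c (i ℤ.+ d) · component d (from x))
    evaluate-contribution [] x c i = sum-replicate-zero N
    evaluate-contribution (d ∷ ds) x c i = begin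
      sum (λ y → (k y ℕ.+ contribution ds y x c i) · from y)
        ≈⟨ sum-cong-≋ (λ y → ×-homo-+ (from y) (k y) _) ⟩
      sum (λ y → k y · from y ∙ contribution ds y x c i · from y)
        ≈⟨ ∑-distrib-+ (λ y → k y · from y) _ ⟩
      sum (λ y → k y · from y) ∙ sum (λ y → contribution ds y x c i · from y)
        ≈⟨ ∙-cong (sum-indicator (target d x) _ from) (evaluate-contribution ds x c i) ⟩
      c (i ℤ.- ℤ.- d) · from (target d x) ∙ _
        ≈⟨ ∙-congʳ (trans (×-congˡ (≡.cong (λ d → c (i ℤ.+ d)) (ℤ.neg-involutive d)))
             (×-congʳ (c (i ℤ.+ d)) (strictlyInverseʳ _))) ⟩
      c (i ℤ.+ d) · component d (from x) ∙ _ ∎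
      where
      k : Fin N → ℕ
      k y = if does (target d x Fin.≟ y) then c (i ℤ.- ℤ.- d) else 0

    sum-sumᵛ : ∀ {n k} (ds : Vec ℤ k) (f : Fin n → ℤ → Carrier) →
      sum (λ x → sumᵛ ds (f x)) ≈ sumᵛ ds (λ d → sum (λ x → f x d))
    sum-sumᵛ {n} [] f = sum-replicate-zero n
    sum-sumᵛ (d ∷ ds) f = trans (∑-distrib-+ (λ x → f x d) _) (∙-congˡ (sum-sumᵛ ds f))

    -- One step of F gives a product of powers of f_d(x) over all x and d. Each f_d(x) is again some
    -- element y, and collecting the factors equal to y gives its next exponent.
    evaluate-counts : ∀ c → (∀ i → from (label (e i)) ≈ c i) →
                      ∀ j i → fold c F j i ≈ evaluate (λ y → counts j y i)
    evaluate-counts c labelled zero    i = sym (trans (sum-indicator (label (e i)) 1 from)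
      (trans (identityʳ _) (labelled i)))
    evaluate-counts c labelled (suc j) i = begin
      F (fold c F j) i
        ≈⟨ F.⟦⟧-cong (evaluate-counts c labelled j) i ⟩
      F (λ i → evaluate (λ y → counts j y i)) i
        ≈⟨ F-local _ i ⟩
      sumᵛ neighbourhood (λ d → component d (evaluate (λ y → counts j y (i ℤ.+ d))))
        ≈⟨ sumᵛ-cong neighbourhood (λ d → trans (component-sum d {N} (λ y → counts j y (i ℤ.+ d) · from y))
             (sum-cong-≋ {N} λ x → component-· d (counts j x (i ℤ.+ d)) (from x))) ⟩
      sumᵛ neighbourhood (λ d → sum (λ x → counts j x (i ℤ.+ d) · component d (from x)))
        ≈⟨ sum-sumᵛ neighbourhood (λ x d → counts j x (i ℤ.+ d) · component d (from x)) ⟨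
      sum (λ x → sumᵛ neighbourhood (λ d → counts j x (i ℤ.+ d) · component d (from x)))
        ≈⟨ sum-cong-≋ (λ x → evaluate-contribution neighbourhood x (counts j x) i) ⟨
      sum (λ x → sum (λ y → contribution neighbourhood y x (counts j x) i · from y))
        ≈⟨ ∑-comm (λ x y → contribution neighbourhood y x (counts j x) i · from y) ⟩
      sum (λ y → sum (λ x → contribution neighbourhood y x (counts j x) i · from y))
        ≈⟨ sum-cong-≋ (λ y → sum-· (λ x → contribution neighbourhood y x (counts j x) i) (from y)) ⟨
      evaluate (λ y → counts (suc j) y i) ∎

    coefficient : ∀ {n} → Vec ℤ n → Fin N → Fin N → Expr
    coefficient []       y x = 𝟘
    coefficient (d ∷ ds) y x = (if does (target d x Fin.≟ y) then u (ℤ.- d) else 𝟘) ⊕ coefficient ds y x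

    indicator : Fin N → Fin m → Fin 2
    indicator y q = if does (label q Fin.≟ y) then suc zero else zero

-- Exponents modulo pᵉ and up to a threshold

%-reduction : ∀ n .{{_ : ℕ.NonZero n}} → ∀ x y → (x % n ℕ.+ y % n) % n ≡ (x ℕ.+ y) % n
%-reduction n x y = ≡.sym (%-distribˡ-+ x y n)

⊓-reduction : ∀ t x y → (x ℕ.⊓ t ℕ.+ y ℕ.⊓ t) ℕ.⊓ t ≡ (x ℕ.+ y) ℕ.⊓ t
⊓-reduction t x y with ℕ.≤-total x t | ℕ.≤-total y t
... | inj₁ x≤t | inj₁ y≤t = ≡.cong₂ (λ a b → (a ℕ.+ b) ℕ.⊓ t) (ℕ.m≤n⇒m⊓n≡m x≤t) (ℕ.m≤n⇒m⊓n≡m y≤t)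
... | inj₂ t≤x | _ = ≡.trans (≡.cong (λ a → (a ℕ.+ y ℕ.⊓ t) ℕ.⊓ t) (ℕ.m≥n⇒m⊓n≡n t≤x))
  (≡.trans (ℕ.m≥n⇒m⊓n≡n (ℕ.m≤m+n t _)) (≡.sym (ℕ.m≥n⇒m⊓n≡n (ℕ.≤-trans t≤x (ℕ.m≤m+n x y)))))
... | inj₁ _ | inj₂ t≤y = ≡.trans (≡.cong (λ b → (x ℕ.⊓ t ℕ.+ b) ℕ.⊓ t) (ℕ.m≥n⇒m⊓n≡n t≤y))
  (≡.trans (ℕ.m≥n⇒m⊓n≡n (ℕ.m≤n+m t _)) (≡.sym (ℕ.m≥n⇒m⊓n≡n (ℕ.≤-trans t≤y (ℕ.m≤n+m y x)))))

⊓-idem : ∀ t x → (x ℕ.⊓ t) ℕ.⊓ t ≡ x ℕ.⊓ t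
⊓-idem t x = ≡.trans (ℕ.⊓-assoc x t t) (≡.cong (x ℕ.⊓_) (ℕ.⊓-idem t))

⊓-saturated : ∀ t x → (suc t ℕ.* x) ℕ.⊓ t ≡ (t ℕ.* x) ℕ.⊓ t
⊓-saturated t zero    = ≡.cong (ℕ._⊓ t) (≡.trans (ℕ.*-zeroʳ (suc t)) (≡.sym (ℕ.*-zeroʳ t)))
⊓-saturated t (suc x) = ≡.trans (ℕ.m≥n⇒m⊓n≡n (ℕ.≤-trans (ℕ.m≤m*n t (suc x)) (ℕ.m≤n+m _ (suc x))))
  (≡.sym (ℕ.m≥n⇒m⊓n≡n (ℕ.m≤m*n t (suc x))))

reduction-classification : ∀ {f} f-idem f-+ K (f<K : ∀ n → f n ℕ.< K) → Classification (Reduction.monoid f f-idem f-+)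
reduction-classification {f} f-idem f-+ K f<K = record
  { classes = K
  ; class = λ n → fromℕ< (f<K n)
  ; rep = toℕ
  ; class-cong = λ {m} {n} eq → Fin.fromℕ<-cong (f m) (f n) eq (f<K m) (f<K n)
  ; rep-class = λ n → ≡.trans (≡.cong f (Fin.toℕ-fromℕ< (f<K n))) (f-idem n)
  }

module Counting (k : ℕ) (M : CommutativeMonoid v ℓ)
  (F : (ℤ → CommutativeMonoid.Carrier M) → (ℤ → CommutativeMonoid.Carrier M))
  (automaton : IsCellularAutomaton (CommutativeMonoid.setoid M) F) (endomorphism : IsEndomorphism M F)
  (finite : Finite (CommutativeMonoid.setoid M)) {m : ℕ} (e : ℤ → Fin m)
  (g : Fin (2 ℕ.+ k) → Fin m → Fin m) (e-step : ∀ s i → e (Automata._⟨+⟩_ (2 ℕ.+ k) i s) ≡ g s (e i))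
  (label : Fin m → Fin (proj₁ finite))
  where
  open LinearAutomaton M F automaton endomorphism
  open Lifting finite e label
  open IsCellularAutomaton automaton using (neighbourhood)

  module _ (f : ℕ → ℕ) (f-idem : ∀ n → f (f n) ≡ f n) (f-+ : ∀ m n → f (f m ℕ.+ f n) ≡ f (m ℕ.+ n))
           (K : ℕ) (f<K : ∀ n → f n ℕ.< K) where
    open Reduction f f-idem f-+ using (monoid)
    open Action monoid
    open Elimination monoid using (combination)
    open Solutions monoid k (reduction-classification f-idem f-+ K f<K) 1 e g e-step
    open import Algebra.Properties.CommutativeMonoid.Sum Diagram using (sum)

    X : Fin N → W
    X y j i = counts j y i

    ⟦coefficient⟧ : ∀ {n} (ds : Vec ℤ n) y x Y j i → ⟦ coefficient ds y x ⟧ Y j i ≡ contribution ds y x (Y j) i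
    ⟦coefficient⟧ []       y x Y j i = ≡.refl
    ⟦coefficient⟧ (d ∷ ds) y x Y j i with does (target d x Fin.≟ y)
    ... | true  = ≡.cong (Y j (i ℤ.- ℤ.- d) ℕ.+_) (⟦coefficient⟧ ds y x Y j i)
    ... | false = ⟦coefficient⟧ ds y x Y j i

    sum-at : ∀ {n} (G : Fin n → W) j i (h : Fin n → ℕ) → (∀ x → G x j i ≡ h x) → sum G j i ≡ Vector.foldr ℕ._+_ 0 h
    sum-at {zero}  G j i h eq = ≡.refl
    sum-at {suc n} G j i h eq = ≡.cong₂ ℕ._+_ (eq zero) (sum-at (G ∘ suc) j i (h ∘ suc) (eq ∘ suc))

    equation : ∀ y → X y ≋ initial (indicator y) +ʷ combination (λ x → z ⊗ coefficient neighbourhood y x) X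
    equation y zero i = ≡.cong f (≡.trans value-indicator (≡.trans (≡.sym (ℕ.+-identityʳ _))
      (≡.cong (value (indicator y (e i)) ℕ.+_) (≡.sym (≡.trans
        (sum-at (λ x → ⟦ z ⊗ coefficient neighbourhood y x ⟧ (X x)) 0 i (λ _ → 0) (λ _ → ≡.refl)) (zeros N))))))
      where
      value-indicator : (if does (label (e i) Fin.≟ y) then 1 else 0) ≡ value (indicator y (e i))
      value-indicator with does (label (e i) Fin.≟ y)
      ... | true  = ≡.refl
      ... | false = ≡.refl
      zeros : ∀ n → Vector.foldr ℕ._+_ 0 {n} (λ _ → 0) ≡ 0
      zeros zero    = ≡.refl
      zeros (suc n) = zeros n
    equation y (suc j) i = ≡.cong f (≡.sym (sum-at (λ x → ⟦ z ⊗ coefficient neighbourhood y x ⟧ (X x)) (suc j) i _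
      (λ x → ⟦coefficient⟧ neighbourhood y x (X x) j i)))

    automatic-counts : (∀ a → Frobenius.Decomposable monoid (suc k) a) → ∀ y → AutomaticDiagram (X y)
    automatic-counts decompose = automatic-solution decompose (coefficient neighbourhood) indicator X equation

-- Appending a base-p digit preserves the sign. The sign of the time is what separates the value ⊥
-- from proper values.
automatic-nonNegative : ∀ k → Automata.Automatic (2 ℕ.+ k) (λ j _ → nonNegative j)
automatic-nonNegative k = 2 , (λ j _ → encode (nonNegative j)) ,
  (decode , λ j _ → ≡.sym (decode-encode (nonNegative j))) ,
  ((λ _ _ x → x) , λ r _ j _ → ≡.cong encode (nonNegative-digit (suc k) j r))
  where
  encode : Bool → Fin 2
  encode false = zero
  encode true  = suc zero
  decode : Fin 2 → Bool
  decode zero    = false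
  decode (suc _) = true
  decode-encode : ∀ b → decode (encode b) ≡ b
  decode-encode false = ≡.refl
  decode-encode true  = ≡.refl

-- Recovering the spacetime diagram from the reduced exponents

module Main (k : ℕ) (p-prime : Prime (2 ℕ.+ k)) (M : CommutativeMonoid v ℓ)
  (F : (ℤ → CommutativeMonoid.Carrier M) → (ℤ → CommutativeMonoid.Carrier M))
  (automaton : IsCellularAutomaton (CommutativeMonoid.setoid M) F) (endomorphism : IsEndomorphism M F)
  (finite : Finite (CommutativeMonoid.setoid M)) (c : ℤ → CommutativeMonoid.Carrier M)
  {m : ℕ} (e : ℤ → Fin m)
  (g : Fin (2 ℕ.+ k) → Fin m → Fin m) (e-step : ∀ s i → e (Automata._⟨+⟩_ (2 ℕ.+ k) i s) ≡ g s (e i))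
  (label : Fin m → Fin (proj₁ finite))
  (labelled : ∀ i → CommutativeMonoid._≈_ M (Inverse.from (proj₂ finite) (label (e i))) (c i))
  where
  open CommutativeMonoid M
  open import Algebra.Properties.CommutativeMonoid.Mult M using (×-congˡ) renaming (_×_ to _·_)
  open import Algebra.Properties.CommutativeMonoid.Sum M using (sum; sum-cong-≋)
  open Inverse (proj₂ finite) using (from)
  open LinearAutomaton M F automaton endomorphism
  open Lifting finite e label
  open Counting k M F automaton endomorphism finite e g e-step label
  open Automata (2 ℕ.+ k)

  module _ (t n ν : ℕ) (p^n≡1+ν : (2 ℕ.+ k) ℕ.^ n ≡ suc ν)
           (return : ∀ y → (t ℕ.+ suc ν) · from y ≈ t · from y) where

    f₁ f₂ : ℕ → ℕ
    f₁ = _% suc ν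
    f₂ = ℕ._⊓ t

    f₁-idem : ∀ x → f₁ (f₁ x) ≡ f₁ x
    f₁-idem x = m%n%n≡m%n x (suc ν)

    f₁< : ∀ x → f₁ x ℕ.< suc ν
    f₁< x = m%n<n x (suc ν)

    f₂< : ∀ x → f₂ x ℕ.< suc t
    f₂< x = s≤s (ℕ.m⊓n≤n x t)

    module R₁ = Reduction f₁ f₁-idem (%-reduction (suc ν))
    module R₂ = Reduction f₂ (⊓-idem t) (⊓-reduction t)

    torsion : ∀ x → f₁ (suc ν R₁.· x) ≡ f₁ 0
    torsion x = ≡.trans (≡.cong f₁ (≡.trans (R₁.·≡* (suc ν) x) (ℕ.*-comm (suc ν) x))) (m*n%n≡0 x (suc ν))

    saturated : ∀ x → f₂ (suc t R₂.· x) ≡ f₂ (t R₂.· x)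
    saturated x = ≡.trans (≡.cong f₂ (R₂.·≡* (suc t) x)) (≡.trans (⊓-saturated t x) (≡.cong f₂ (≡.sym (R₂.·≡* t x))))

    at : (ℕ → ℤ → ℕ) → ℤ → ℤ → ℕ
    at X (+ j)    i = X j i
    at X -[1+ _ ] i = 0

    class₁ : ∀ y → Automatic (λ j i → fromℕ< (f₁< (at (λ j i → counts j y i) j i)))
    class₁ y = automatic-map (λ c → c)
      (automatic-counts f₁ f₁-idem (%-reduction (suc ν)) (suc ν) f₁<
        (Frobenius.Torsion.decompose R₁.monoid (suc k) p-prime n ν p^n≡1+ν torsion) y)
      λ { (+ _) _ → ≡.refl ; -[1+ _ ] _ → ≡.refl }

    class₂ : ∀ y → Automatic (λ j i → fromℕ< (f₂< (at (λ j i → counts j y i) j i)))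
    class₂ y = automatic-map (λ c → c)
      (automatic-counts f₂ (⊓-idem t) (⊓-reduction t) (suc t) f₂<
        (Threshold.Saturated.decompose R₂.monoid (suc k) t saturated) y)
      λ { (+ _) _ → ≡.refl ; -[1+ _ ] _ → ≡.refl }

    -- A saturated count below t is the count itself. Otherwise the count is at least t, and the
    -- representative from `canonical` is taken.
    exponent : Fin (suc ν) ∧ Fin (suc t) → ℕ
    exponent (r , s) = if does (toℕ s ℕ.<? t) then toℕ s else toℕ r ℕ.+ t ℕ.* suc ν

    classes : ℕ → Fin (suc ν) ∧ Fin (suc t)
    classes x = fromℕ< (f₁< x) , fromℕ< (f₂< x)

    exponent-classes : ∀ x y → x · from y ≈ exponent (classes x) · from y
    exponent-classes x y rewrite Fin.toℕ-fromℕ< (f₁< x) | Fin.toℕ-fromℕ< (f₂< x) with x ℕ.<? t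
    ... | yes x<t rewrite ℕ.m≤n⇒m⊓n≡m (ℕ.<⇒≤ x<t) | dec-true (x ℕ.<? t) x<t = refl
    ... | no x≮t rewrite ℕ.m≥n⇒m⊓n≡n (ℕ.≮⇒≥ x≮t) | dec-false (t ℕ.<? t) (ℕ.<-irrefl ≡.refl) =
      Periodicity.canonical M {from y} {t} {suc ν} (return y) x (ℕ.≮⇒≥ x≮t)

    Reading : Set
    Reading = Vec (Fin (suc ν) ∧ Fin (suc t)) N ∧ Bool

    readings : ℤ → ℤ → Reading
    readings j i = Vec.tabulate (λ y → classes (at (λ j i → counts j y i) j i)) , nonNegative j

    automatic-readings : Automatic readings
    automatic-readings = automatic-zip
      (automatic-tabulate (λ y j i → classes (at (λ j i → counts j y i) j i)) (λ y → automatic-zip (class₁ y) (class₂ y)))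
      (automatic-nonNegative k)

    interpret : Reading → Maybe Carrier
    interpret (_  , false) = nothing
    interpret (rs , true)  = just (sum (λ y → exponent (Vec.lookup rs y) · from y))

    interpret-readings : ∀ x → Maybe.Pointwise _≈_ (extend setoid ℤ×ℕ? (spacetime setoid F c) x)
                                 (interpret (readings (Vec.lookup x (suc zero)) (Vec.lookup x zero)))
    interpret-readings (i ∷ + j ∷ []) = Maybe.just (trans (evaluate-counts c labelled j i)
      (sum-cong-≋ {N} λ y → trans (exponent-classes (counts j y i) y)
        (×-congˡ (≡.cong exponent (≡.sym (Vec.lookup∘tabulate (λ y → classes (counts j y i)) y))))))
    interpret-readings (i ∷ -[1+ j ] ∷ []) = Maybe.nothing

    automatic-spacetime : IsAutomaticSpacetime setoid (2 ℕ.+ k) F c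
    automatic-spacetime = from-automatic automatic-readings
      where
      from-automatic : Automatic readings → IsAutomaticSpacetime setoid (2 ℕ.+ k) F c
      from-automatic (m , E , (h , eq) , (G , step)) =
        m , (λ x → E (Vec.lookup x (suc zero)) (Vec.lookup x zero)) ,
        (interpret ∘ h , λ x → ≡.subst (λ r → Maybe.Pointwise _≈_ (extend setoid ℤ×ℕ? (spacetime setoid F c) x) (interpret r))
          (eq _ _) (interpret-readings x)) ,
        ((λ s → G (Vec.lookup s (suc zero)) (Vec.lookup s zero)) ,
         λ { (s ∷ r ∷ []) (i ∷ j ∷ []) → step r s j i })

theorem3 : ∀ {a ℓ} (p : ℕ) → Prime p →
    (M : CommutativeMonoid a ℓ) → let open CommutativeMonoid M in
    Finite setoid → π M ⊆ ｛ p ｝ →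
    (F : (ℤ → Carrier) → (ℤ → Carrier)) →
    IsCellularAutomaton setoid F → IsEndomorphism M F →
    (c : ℤ → Carrier) → IsAutomaticConfiguration setoid p c →
    IsAutomaticSpacetime setoid p F c
theorem3 0 p-prime = contradiction p-prime ¬prime[0]
theorem3 1 p-prime = contradiction p-prime ¬prime[1]
theorem3 p@(suc (suc k)) p-prime M finite π⊆p F automaton endomorphism c (m , e , (h , c≈) , (g , e-step)) =
  conclude (Periodicity.uniform M finite p π⊆p from)
  where
  open CommutativeMonoid M
  open Inverse (proj₂ finite) using (to; from; strictlyInverseʳ)

  label : Maybe Carrier → Fin (proj₁ finite)
  -- Since `c` is defined everywhere, no position has a state with output `nothing`; the default ε
  -- is arbitrary.
  label = maybe′ to (to ε)

  label-just : ∀ {x y} → Maybe.Pointwise _≈_ (just x) y → from (label y) ≈ x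
  label-just (Maybe.just x≈y) = trans (strictlyInverseʳ _) (sym x≈y)

  conclude : Periodicity.Uniform M finite p π⊆p from → IsAutomaticSpacetime setoid p F c
  conclude (t , n , return) = Main.automatic-spacetime k p-prime M F automaton endomorphism finite c
    (λ i → e (i ∷ [])) (λ s → g (s ∷ [])) (λ s i → e-step (s ∷ []) (i ∷ [])) (label ∘ h) (λ i → label-just (c≈ (i ∷ [])))
    t n (ℕ.pred (p ℕ.^ n)) p^n≡ (λ y → ≡.subst (λ q → t-return q y) p^n≡ (return y))
    where
    open import Algebra.Properties.Monoid.Mult monoid using () renaming (_×_ to _·_)
    p^n≡ : p ℕ.^ n ≡ suc (ℕ.pred (p ℕ.^ n))
    p^n≡ = ≡.sym (ℕ.suc-pred (p ℕ.^ n) {{ℕ.m^n≢0 p n}})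
    t-return : ℕ → Fin (proj₁ finite) → Set _
    t-return q y = (t ℕ.+ q) · from y ≈ t · from y
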